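{- There is a positive constant $c$ and, for all fixed integers $a\ge b\ge 2$, a positive constant $c'=c'_a$ such that for all integers $n\ge 2$, \[ 2^{c\log^2 n}\;\le\; \mathrm{gr}(\Gamma_{a\times b},K_n)\;\le\; 2^{c' n^{1-(2^b-1)^{ -1}}\log n}. \]
   Context: The $m\times n$ grid graph $\Gamma_{m\times n}$ is the Cartesian product $K_m\square K_n$: its vertex set is $[m]\times[n]$ and two distinct vertices are adjacent iff they share exactly one coordinate. An $a\times b$ subgrid of $\Gamma_{m\times n}$ is an induced copy of $\Gamma_{a\times b}$, i.e. the induced subgraph on $X\times Y$ with $|X|=a$, $|Y|=b$ (or with the roles of the two coordinates swapped). $\mathrm{gr}(\Gamma_{a\times b},K_n)$ is the smallest $N$ such that every red/blue coloring of the edges of $\Gamma_{N\times N}$ contains an $a\times b$ subgrid all of whose edges are red, or a clique on $n$ vertices all of whose edges are blue. Logarithms are base $2$. -}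

module Defs where

open import Data.Nat using (ℕ; zero; suc; _+_; _*_; _∸_; _^_; _≤_; _<_)
open import Data.Fin using (Fin)
open import Data.Product using (Σ; _×_; _,_)
open import Data.Sum using (_⊎_)
open import Relation.Nullary using (¬_)
open import Relation.Binary.PropositionalEquality using (_≡_)
open import Function.Definitions using (Injective)

Vertex : ℕ → Set
Vertex N = Fin N × Fin N

Adj : {N : ℕ} → Vertex N → Vertex N → Set
Adj (x , y) (x' , y') = (x ≡ x' × ¬ y ≡ y') ⊎ (¬ x ≡ x' × y ≡ y')

data Colour : Set where
  red blue : Colour

-- A red/blue colouring of the edges of Γ_{N×N}: a symmetric colour
-- function on pairs of vertices (only its values on edges matter).
Colouring : ℕ → Set
Colouring N = Vertex N → Vertex N → Colour

Symmetric : {N : ℕ} → Colouring N → Set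
Symmetric {N} χ = (u v : Vertex N) → χ u v ≡ χ v u

-- An a×b subgrid is the induced subgraph on X×Y (|X| = a, |Y| = b),
-- or on the coordinate-swapped copy.
data Orientation : Set where
  straight swapped : Orientation

place : {N : ℕ} → Orientation → Fin N → Fin N → Vertex N
place straight x y = (x , y)
place swapped  x y = (y , x)

HasRedSubgrid : (a b : ℕ) {N : ℕ} → Colouring N → Set
HasRedSubgrid a b {N} χ =
  Σ (Fin a → Fin N) λ X → Σ (Fin b → Fin N) λ Y →
    Injective _≡_ _≡_ X × Injective _≡_ _≡_ Y ×
    Σ Orientation λ o →
      (i i' : Fin a) (j j' : Fin b) →
        Adj (place o (X i) (Y j)) (place o (X i') (Y j')) →
        χ (place o (X i) (Y j)) (place o (X i') (Y j')) ≡ red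

HasBlueClique : (n : ℕ) {N : ℕ} → Colouring N → Set
HasBlueClique n {N} χ =
  Σ (Fin n → Vertex N) λ g →
    Injective _≡_ _≡_ g ×
    ((i j : Fin n) → ¬ i ≡ j → Adj (g i) (g j) × χ (g i) (g j) ≡ blue)

Arrows : (a b n N : ℕ) → Set
Arrows a b n N = (χ : Colouring N) → Symmetric χ →
  HasRedSubgrid a b χ ⊎ HasBlueClique n χ

IsGr : (a b n N : ℕ) → Set
IsGr a b n N = Arrows a b n N × ((M : ℕ) → Arrows a b n M → N ≤ M)

-- Real-number inequalities encoded exactly in integer arithmetic.
-- For q ≥ 1 and n ≥ 1:  p/q ≤ log₂ n  iff  2^p ≤ n^q.

LogAtLeast : (n p q : ℕ) → Set
LogAtLeast n p q = 2 ^ p ≤ n ^ q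

-- LowerBound u v n N  ⇔  2^{(u/v) log² n} ≤ N
-- i.e. (u/v)(log n)² ≤ log N, i.e. for every rational p/q ≤ log n,
-- (u/v)(p/q)² ≤ log N, i.e. 2^{u p²} ≤ N^{v q²}.
LowerBound : (u v n N : ℕ) → Set
LowerBound u v n N =
  (p q : ℕ) → 1 ≤ q → LogAtLeast n p q → LogAtLeast N (u * (p * p)) (v * (q * q))

-- UpperBound u v b n N  ⇔  N ≤ 2^{(u/v) n^{1-1/m} log n},  m = 2^b - 1,
-- i.e. log N ≤ (u/v) n^{(m-1)/m} log n.  Encoded as: for every rational
-- p/q ≤ log N and every rational p'/q' with p'/q' · u n^{(m-1)/m} < p v / q
-- (equivalently (p' q u)^m n^{m-1} < (p v q')^m) we have p'/q' ≤ log n.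
UpperBound : (u v b n N : ℕ) → Set
UpperBound u v b n N =
  (p q p' q' : ℕ) → 1 ≤ q → 1 ≤ q' →
    LogAtLeast N p q →
    (p' * q * u) ^ m * n ^ (m ∸ 1) < (p * v * q') ^ m →
    LogAtLeast n p' q'
  where
  m : ℕ
  m = 2 ^ b ∸ 1

{-# OPTIONS --safe #-}

-- Lower bound. Let the rows be bit strings of length D = t² and give the columns words of length D over
-- an alphabet of size 4^t, two of which agree in at most 2t places. Label every pair of columns and every
-- pair of rows. In column y the rows x, x′ are joined in red if their label is the symbol of y at a place
-- where x and x′ differ; in row x the columns y, y′ are joined in red if their label spells the bits of x
-- at the places where y and y′ agree. A red 2 × 2 subgrid would contain two rows that both differ and
-- coincide at some place. Random labels leave no blue clique of size about 16^t, so gr > 2^(t²).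
--
-- Upper bound. With m = 2^b − 1, ℓ ≈ n^(1/m) and k = b ℓ, many rows share a red clique on the same k
-- columns. Then no b of the red graphs in these columns have a common K_a, and after passing to common
-- neighbourhoods at most a k^b times the b-fold intersections are negligible. So the k red graphs are
-- almost disjoint, and some b of them have densities about 1/ℓ. By the argument of Erdős and Szemerédi,
-- maximal blue cliques in these b columns confine their independence numbers to O(n/ℓ) on a large set
-- of rows, where Ramsey's theorem for b + 1 colours applies. All losses are n^O(n/ℓ), as k^b = O(n/ℓ).
module Submission where

open import Defs
open import Data.Bool using (Bool; true; false; if_then_else_; not; _∨_; T; T?)
open import Data.Empty using (⊥; ⊥-elim)
open import Data.Fin as Fin using (Fin; zero; suc; toℕ; combine; finToFun; funToFin; inject≤)
import Data.Fin.Properties as FinP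
open import Data.List using (List; tabulate; []; _∷_; _++_; map; length; filter; allFin; take; cartesianProduct; lookup)
import Data.List.Properties as ListP
open import Data.List.Membership.Propositional using (_∈_; find)
open import Data.List.Membership.Propositional.Properties as MemP using (∈-allFin)
open import Data.List.Relation.Binary.Sublist.Propositional using (_⊆_; []; _∷_; _∷ʳ_; ⊆-trans; minimum)
open import Data.List.Relation.Binary.Sublist.Propositional.Properties as SubP using (filter-⊆; length-mono-≤)
open import Data.List.Relation.Unary.All as All using (All; []; _∷_)
import Data.List.Relation.Unary.All.Properties as AllP
open import Data.List.Relation.Unary.AllPairs as AllPairs using (AllPairs; []; _∷_)
import Data.List.Relation.Unary.AllPairs.Properties as AllPairsP
open import Data.List.Relation.Unary.Any using (here; there)
open import Data.List.Relation.Unary.Unique.Propositional using (Unique)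
import Data.List.Relation.Unary.Unique.Propositional.Properties as UniqueP
open import Data.Maybe using (Maybe; just; nothing; is-just)
import Data.Maybe.Properties as MaybeP
import Data.Product.Properties as ProdP
open import Data.Nat
open import Data.Nat.Properties
open import Data.Nat.DivMod using (m≡m%n+[m/n]*n; m%n<n; m/n*n≤m)
open import Data.Nat.Tactic.RingSolver using (solve-∀)
open import Data.Product using (swap; Σ; ∃; _×_; _,_; proj₁; proj₂)
open import Data.Sum using (_⊎_; inj₁; inj₂)
open import Data.Unit using (tt)
open import Function using (_∘_; id; Injective)
open import Relation.Binary using (DecidableEquality)
open import Relation.Binary.PropositionalEquality hiding ([_])
open import Relation.Nullary using (¬_; Dec; yes; no; does; contradiction)
open import Relation.Nullary.Decidable using (decidable-stable; _×-dec_; _⊎-dec_; ¬?; map′; _→-dec_)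

-- Sums, pigeonhole principles and sublists

-- In a block of density about 1/ℓ a typical row is red to only `t` = O(n/ℓ) of the at most `b * n`
-- members of a labelled blue clique, so the members to be given up can be named in n^O(n/ℓ) ways,
-- while arbitrary subsets would cost 2^(b n). This favours a large ℓ, until two other costs
-- intervene: about a k^b passes to common neighbourhoods may be made, each dividing the number of
-- rows by n^O(1), and the choice of k columns among (n + 1)^k costs (n + 1)^(k²). Both remain
-- n^O(n/ℓ) as long as ℓ^b and ℓ^2 are O(n/ℓ), which holds for ℓ ≈ n^(1/m) because m - 1 = 2^b - 2
-- is at least b and at least 2.
--
-- In the lower bound both kinds of label share one alphabet: two words agree in at most 2t places,
-- so the bits spelled there form one of 4^t symbols. A label then meets a prescribed target with
-- chance 4^(-t). The random choices are made by conditional expectations, and the least N is found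
-- by a bounded search, so that the whole argument is constructive.

sel : {A : Set} → (A → Bool) → List A → List A
sel p = filter (λ x → T? (p x))

𝟙 : Bool → ℕ
𝟙 b = if b then 1 else 0

∑ : {A : Set} → (A → ℕ) → List A → ℕ
∑ f []      = 0
∑ f (x ∷ L) = f x + ∑ f L

∑-mono : {A : Set} {f g : A → ℕ} {L : List A} → All (λ x → f x ≤ g x) L → ∑ f L ≤ ∑ g L
∑-mono []       = z≤n
∑-mono (p ∷ ps) = +-mono-≤ p (∑-mono ps)

∑-cong : {A : Set} {f g : A → ℕ} → (∀ x → f x ≡ g x) → (L : List A) → ∑ f L ≡ ∑ g L
∑-cong e []      = refl
∑-cong e (x ∷ L) = cong₂ _+_ (e x) (∑-cong e L)

∑-+ : {A : Set} (f g : A → ℕ) (L : List A) → ∑ (λ x → f x + g x) L ≡ ∑ f L + ∑ g L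
∑-+ f g []      = refl
∑-+ f g (x ∷ L) rewrite ∑-+ f g L = lem (f x) (g x) (∑ f L) (∑ g L)
  where
  lem : ∀ a b c d → a + b + (c + d) ≡ a + c + (b + d)
  lem = solve-∀

∑-*ˡ : {A : Set} (c : ℕ) (f : A → ℕ) (L : List A) → ∑ (λ x → c * f x) L ≡ c * ∑ f L
∑-*ˡ c f []      = sym (*-zeroʳ c)
∑-*ˡ c f (x ∷ L) rewrite ∑-*ˡ c f L = sym (*-distribˡ-+ c (f x) (∑ f L))

∑-const : {A : Set} (c : ℕ) (L : List A) → ∑ (λ _ → c) L ≡ length L * c
∑-const c []      = refl
∑-const c (x ∷ L) = cong (c +_) (∑-const c L)

∑-swap : {A B : Set} (f : A → B → ℕ) (L : List A) (M : List B) →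
         ∑ (λ x → ∑ (f x) M) L ≡ ∑ (λ y → ∑ (λ x → f x y) L) M
∑-swap f []      M = sym (trans (∑-const 0 M) (*-zeroʳ (length M)))
∑-swap f (x ∷ L) M =
  trans (cong (∑ (f x) M +_) (∑-swap f L M)) (sym (∑-+ (f x) (λ y → ∑ (λ z → f z y) L) M))

∑-++ : {A : Set} (f : A → ℕ) (L M : List A) → ∑ f (L ++ M) ≡ ∑ f L + ∑ f M
∑-++ f []      M = refl
∑-++ f (x ∷ L) M = trans (cong (f x +_) (∑-++ f L M)) (sym (+-assoc (f x) (∑ f L) (∑ f M)))

∑-map : {A B : Set} (f : B → ℕ) (g : A → B) (L : List A) → ∑ f (map g L) ≡ ∑ (λ x → f (g x)) L
∑-map f g []      = refl
∑-map f g (x ∷ L) = cong (f (g x) +_) (∑-map f g L)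

∑-cartesianProduct : {A B : Set} (f : A × B → ℕ) (L : List A) (M : List B) →
  ∑ f (cartesianProduct L M) ≡ ∑ (λ x → ∑ (λ y → f (x , y)) M) L
∑-cartesianProduct f []      M = refl
∑-cartesianProduct f (x ∷ L) M = trans (∑-++ f (map (x ,_) M) (cartesianProduct L M))
  (cong₂ _+_ (∑-map f (x ,_) M) (∑-cartesianProduct f L M))

∑-sel : {A : Set} (f : A → ℕ) (p : A → Bool) (L : List A) →
           ∑ f (sel p L) ≡ ∑ (λ x → 𝟙 (p x) * f x) L
∑-sel f p []      = refl
∑-sel f p (x ∷ L) with p x
... | true  = cong₂ _+_ (sym (+-identityʳ (f x))) (∑-sel f p L)
... | false = ∑-sel f p L

length-sel : {A : Set} (p : A → Bool) (L : List A) → length (sel p L) ≡ ∑ (λ x → 𝟙 (p x)) L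
length-sel p []      = refl
length-sel p (x ∷ L) with p x
... | true  = cong suc (length-sel p L)
... | false = length-sel p L

length-filter-split : {A : Set} {P : A → Set} (P? : ∀ x → Dec (P x)) (L : List A) →
  length (filter P? L) + length (filter (λ x → ¬? (P? x)) L) ≡ length L
length-filter-split P? []      = refl
length-filter-split P? (x ∷ L) with P? x
... | yes _ = cong suc (length-filter-split P? L)
... | no  _ = trans (+-suc _ _) (cong suc (length-filter-split P? L))

AllPairs-resp-⊆ : {A : Set} {R : A → A → Set} {L M : List A} → L ⊆ M → AllPairs R M → AllPairs R L
AllPairs-resp-⊆ []         []       = []
AllPairs-resp-⊆ (_ ∷ʳ s)   (_ ∷ ps) = AllPairs-resp-⊆ s ps
AllPairs-resp-⊆ (refl ∷ s) (p ∷ ps) = SubP.All-resp-⊆ s p ∷ AllPairs-resp-⊆ s ps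

length-filter*≤∑ : {A : Set} {P : A → Set} (P? : ∀ x → Dec (P x)) (f : A → ℕ) (c : ℕ) →
  (∀ x → P x → c ≤ f x) → (L : List A) → length (filter P? L) * c ≤ ∑ f L
length-filter*≤∑ P? f c h []      = z≤n
length-filter*≤∑ P? f c h (x ∷ L) with P? x
... | yes p = +-mono-≤ (h x p) (length-filter*≤∑ P? f c h L)
... | no  _ = ≤-trans (length-filter*≤∑ P? f c h L) (m≤n+m _ (f x))

Markov : {A : Set} (f : A → ℕ) (s : ℕ) (L : List A) → ∑ f L ≤ s * length L →
         length L ≤ 2 * length (filter (λ x → f x ≤? 2 * s) L)
Markov f s L h = +-cancelʳ-≤ (length L) (length L) (2 * good) (begin
    length L + length L    ≡⟨ cong (λ z → z + z) (sym split) ⟩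
    good + bad + (good + bad)   ≡⟨ lem good bad ⟩
    2 * good + 2 * bad     ≤⟨ +-monoʳ-≤ (2 * good) 2bad≤ ⟩
    2 * good + length L    ∎)
  where
  open ≤-Reasoning
  good = length (filter (λ x → f x ≤? 2 * s) L)
  bad  = length (filter (λ x → ¬? (f x ≤? 2 * s)) L)
  split : good + bad ≡ length L
  split = length-filter-split (λ x → f x ≤? 2 * s) L
  lem : ∀ g b → g + b + (g + b) ≡ 2 * g + 2 * b
  lem = solve-∀
  2bad≤ : 2 * bad ≤ length L
  2bad≤ = *-cancelʳ-≤ (2 * bad) (length L) (suc (2 * s)) (begin
    2 * bad * suc (2 * s)   ≡⟨ *-assoc 2 bad (suc (2 * s)) ⟩
    2 * (bad * suc (2 * s)) ≤⟨ *-monoʳ-≤ 2 (length-filter*≤∑ (λ x → ¬? (f x ≤? 2 * s)) f (suc (2 * s)) (λ _ → ≰⇒>) L) ⟩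
    2 * ∑ f L               ≤⟨ *-monoʳ-≤ 2 h ⟩
    2 * (s * length L)      ≡⟨ sym (*-assoc 2 s (length L)) ⟩
    2 * s * length L        ≤⟨ *-monoˡ-≤ (length L) (n≤1+n (2 * s)) ⟩
    suc (2 * s) * length L  ≡⟨ *-comm (suc (2 * s)) (length L) ⟩
    length L * suc (2 * s)  ∎)

below-average : {A : Set} (f : A → ℕ) (x : A) (L : List A) →
  ∃ λ z → z ∈ x ∷ L × length (x ∷ L) * f z ≤ ∑ f (x ∷ L)
below-average f x []      = x , here refl , ≤-refl
below-average f x (y ∷ L) with below-average f y L
... | z , z∈ , h with f x ≤? f z
...   | yes p = x , here refl , +-monoʳ-≤ (f x) (≤-trans (*-monoʳ-≤ (suc (length L)) p) h)
...   | no  p = z , there z∈ , +-mono-≤ (<⇒≤ (≰⇒> p)) h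

pigeonhole : {A B : Set} (_≟ᴮ_ : DecidableEquality B) (f : A → B) (m : ℕ) (codes : List B) (L : List A) →
  All (λ x → f x ∈ codes) L → m * length codes < length L →
  ∃ λ c → c ∈ codes × m < length (filter (λ x → f x ≟ᴮ c) L)
pigeonhole _≟ᴮ_ f m []       []      _        ()
pigeonhole _≟ᴮ_ f m []       (x ∷ L) (() ∷ _) _
pigeonhole {A} _≟ᴮ_ f m (c ∷ cs) L all big with m <? length (filter (λ x → f x ≟ᴮ c) L)
... | yes p = c , here refl , p
... | no ¬p with pigeonhole _≟ᴮ_ f m cs rest rest∈ rest-big
  where
  rest : List A
  rest = filter (λ x → ¬? (f x ≟ᴮ c)) L
  tail∈ : ∀ {x} → f x ∈ c ∷ cs × ¬ f x ≡ c → f x ∈ cs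
  tail∈ (here e  , ne) = contradiction e ne
  tail∈ (there i , _)  = i
  rest∈ : All (λ x → f x ∈ cs) rest
  rest∈ = All.zipWith tail∈ (AllP.filter⁺ (λ x → ¬? (f x ≟ᴮ c)) all , AllP.all-filter (λ x → ¬? (f x ≟ᴮ c)) L)
  rest-big : m * length cs < length rest
  rest-big = +-cancelˡ-< m _ _ (begin-strict
    m + m * length cs       ≡⟨ sym (*-suc m (length cs)) ⟩
    m * suc (length cs)     <⟨ big ⟩
    length L                ≡⟨ sym (length-filter-split (λ x → f x ≟ᴮ c) L) ⟩
    length (filter (λ x → f x ≟ᴮ c) L) + length rest ≤⟨ +-monoˡ-≤ (length rest) (≮⇒≥ ¬p) ⟩
    m + length rest         ∎)
    where open ≤-Reasoning
...   | c′ , c′∈ , h = c′ , there c′∈ , ≤-trans h (length-mono-≤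
          (SubP.filter⁺ (λ x → f x ≟ᴮ c′) (λ x → f x ≟ᴮ c′) (λ { refl → id }) (filter-⊆ (λ x → ¬? (f x ≟ᴮ c)) L)))

sublists : {A : Set} → ℕ → List A → List (List A)
sublists zero    L       = [] ∷ []
sublists (suc s) []      = []
sublists (suc s) (x ∷ L) = map (x ∷_) (sublists s L) ++ sublists (suc s) L

⊆⇒∈sublists : {A : Set} {J L : List A} → J ⊆ L → J ∈ sublists (length J) L
⊆⇒∈sublists {J = []}    s = here refl
⊆⇒∈sublists {J = j ∷ J} (y ∷ʳ s)   = MemP.∈-++⁺ʳ (map (y ∷_) (sublists (length J) _)) (⊆⇒∈sublists s)
⊆⇒∈sublists {J = j ∷ J} (refl ∷ s) = MemP.∈-++⁺ˡ (MemP.∈-map⁺ (j ∷_) (⊆⇒∈sublists s))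

∈sublists⇒⊆ : {A : Set} (s : ℕ) {J : List A} (L : List A) → J ∈ sublists s L → J ⊆ L × length J ≡ s
∈sublists⇒⊆ zero    L       (here refl) = minimum L , refl
∈sublists⇒⊆ (suc s) (x ∷ L) j∈ with MemP.∈-++⁻ (map (x ∷_) (sublists s L)) j∈
... | inj₂ i = let (a , b) = ∈sublists⇒⊆ (suc s) L i in x ∷ʳ a , b
... | inj₁ i with MemP.∈-map⁻ (x ∷_) i
...   | J′ , i′ , refl = let (a , b) = ∈sublists⇒⊆ s L i′ in refl ∷ a , cong suc b

length-sublists-suc : {A : Set} (s : ℕ) (x : A) (L : List A) →
  length (sublists (suc s) (x ∷ L)) ≡ length (sublists s L) + length (sublists (suc s) L)
length-sublists-suc s x L = trans (ListP.length-++ (map (x ∷_) (sublists s L)))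
  (cong (_+ length (sublists (suc s) L)) (ListP.length-map (x ∷_) (sublists s L)))

length-sublists≤^ : {A : Set} (s : ℕ) (L : List A) → length (sublists s L) ≤ length L ^ s
length-sublists≤^ zero    L       = ≤-refl
length-sublists≤^ (suc s) []      = z≤n
length-sublists≤^ (suc s) (x ∷ L) = begin
  length (sublists (suc s) (x ∷ L))                   ≡⟨ length-sublists-suc s x L ⟩
  length (sublists s L) + length (sublists (suc s) L)    ≤⟨ +-mono-≤ (length-sublists≤^ s L) (length-sublists≤^ (suc s) L) ⟩
  l ^ s + l * l ^ s                                ≤⟨ *-monoʳ-≤ (suc l) (^-monoˡ-≤ s (n≤1+n l)) ⟩
  suc l * suc l ^ s                                ∎
  where
  open ≤-Reasoning
  l = length L

length-sublists-long : {A : Set} (s : ℕ) (L : List A) → length L < s → length (sublists s L) ≡ 0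
length-sublists-long (suc s) []      h = refl
length-sublists-long (suc s) (x ∷ L) (s≤s h) = trans (length-sublists-suc s x L)
  (cong₂ _+_ (length-sublists-long s L h) (length-sublists-long (suc s) L (m<n⇒m<1+n h)))

-- A sublist of length `s` leaves out at most `t` entries, and these can be named in
-- `suc (length L) ^ t` ways. The exponent `t` in place of `s` is the saving on which the upper
-- bound rests.
length-sublists≤co^ : {A : Set} (s t : ℕ) (L : List A) → length L ≤ s + t → length (sublists s L) ≤ suc (length L) ^ t
length-sublists≤co^ zero    t       L       h = m^n>0 (suc (length L)) t
length-sublists≤co^ (suc s) t       []      h = z≤n
length-sublists≤co^ (suc s) zero    (x ∷ L) (s≤s h) = begin
  length (sublists (suc s) (x ∷ L))                   ≡⟨ length-sublists-suc s x L ⟩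
  length (sublists s L) + length (sublists (suc s) L)    ≡⟨ cong (length (sublists s L) +_) (length-sublists-long (suc s) L (s≤s (≤-trans h (≤-reflexive (+-identityʳ s))))) ⟩
  length (sublists s L) + 0                           ≡⟨ +-identityʳ _ ⟩
  length (sublists s L)                               ≤⟨ length-sublists≤co^ s 0 L h ⟩
  1                                                ∎
  where open ≤-Reasoning
length-sublists≤co^ (suc s) (suc t) (x ∷ L) (s≤s h) = begin
  length (sublists (suc s) (x ∷ L))                   ≡⟨ length-sublists-suc s x L ⟩
  length (sublists s L) + length (sublists (suc s) L)    ≤⟨ +-mono-≤ (length-sublists≤co^ s (suc t) L h)
                                                       (length-sublists≤co^ (suc s) t L (≤-trans h (≤-reflexive (+-suc s t)))) ⟩
  suc l * suc l ^ t + suc l ^ t                    ≡⟨ +-comm (suc l * suc l ^ t) (suc l ^ t) ⟩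
  suc (suc l) * suc l ^ t                          ≤⟨ *-monoʳ-≤ (suc (suc l)) (^-monoˡ-≤ t (n≤1+n (suc l))) ⟩
  suc (suc l) * suc (suc l) ^ t                    ∎
  where
  open ≤-Reasoning
  l = length L

-- Cutting the list of each `u` down to its first `s` entries makes the choice canonical, so that
-- the pigeonholes are the `s`-sublists of `L`. It serves twice: for members of a blue clique that
-- many rows avoid, and for columns in which many rows are joined to one row.
common-sublist : {A C : Set} → DecidableEquality C → (p : A → C → Bool) (s m : ℕ) (L : List C) (U : List A) →
  All (λ u → s ≤ length (sel (p u) L)) U → m * length (sublists s L) < length U →
  ∃ λ J → J ∈ sublists s L × ∃ λ U′ → U′ ⊆ U × m < length U′ × All (λ u → All (λ c → T (p u c)) J) U′
common-sublist {A} _≟ᶜ_ p s m L U enough big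
  with pigeonhole (ListP.≡-dec _≟ᶜ_) (λ u → take s (sel (p u) L)) m (sublists s L) U (All.map first∈ enough) big
  where
  first∈ : ∀ {u} → s ≤ length (sel (p u) L) → take s (sel (p u) L) ∈ sublists s L
  first∈ {u} h = subst (λ z → take s (sel (p u) L) ∈ sublists z L)
    (trans (ListP.length-take s (sel (p u) L)) (m≤n⇒m⊓n≡m h))
    (⊆⇒∈sublists (⊆-trans (SubP.take-⊆ s (sel (p u) L)) (filter-⊆ (λ c → T? (p u c)) L)))
... | J , J∈ , h = J , J∈ , filter _ U , filter-⊆ _ U , h ,
      All.map (λ { {u} refl → AllP.take⁺ s (AllP.all-filter (λ c → T? (p u c)) L) }) (AllP.all-filter _ U)

-- Ramsey arguments

-- `suc n ^ k` dominates the recursion R(k, n) ≤ R(k - 1, n) + R(k, n - 1). Only pairs in list order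
-- are compared, which fits `AllPairs` and any relation `p`.
off-diagonal-Ramsey : {A : Set} (p : A → A → Bool) (k n : ℕ) (U : List A) → suc n ^ k ≤ length U →
  (∃ λ K → K ⊆ U × length K ≡ k × AllPairs (λ v u → T (p v u)) K) ⊎
  (∃ λ K → K ⊆ U × length K ≡ n × AllPairs (λ v u → ¬ T (p v u)) K)
off-diagonal-Ramsey p zero    n       U       h = inj₁ ([] , minimum U , refl , [])
off-diagonal-Ramsey p (suc k) zero    U       h = inj₂ ([] , minimum U , refl , [])
off-diagonal-Ramsey p (suc k) (suc n) []      h = contradiction h (<⇒≱ (m^n>0 (suc (suc n)) (suc k)))
off-diagonal-Ramsey {A} p (suc k) (suc n) (v ∷ U) h
  with suc (suc n) ^ k ≤? length (sel (p v) U)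
... | yes big with off-diagonal-Ramsey p k (suc n) (sel (p v) U) big
...   | inj₂ (K , K⊆ , len , blues) = inj₂ (K , v ∷ʳ ⊆-trans K⊆ (filter-⊆ _ U) , len , blues)
...   | inj₁ (K , K⊆ , len , reds)  = inj₁ (v ∷ K , refl ∷ ⊆-trans K⊆ (filter-⊆ _ U) , cong suc len ,
          SubP.All-resp-⊆ K⊆ (AllP.all-filter (λ u → T? (p v u)) U) ∷ reds)
off-diagonal-Ramsey {A} p (suc k) (suc n) (v ∷ U) h | no small
  with off-diagonal-Ramsey p (suc k) n (filter (λ u → ¬? (T? (p v u))) U) (+-cancelˡ-≤ (suc r) _ _ (begin
    suc r + suc n * suc n ^ k                    ≤⟨ +-mono-≤ (≰⇒> small) (*-monoʳ-≤ (suc n) (^-monoˡ-≤ k (n≤1+n (suc n)))) ⟩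
    suc (suc n) ^ k + suc n * suc (suc n) ^ k    ≤⟨ h ⟩
    suc (length U)                               ≡⟨ cong suc (sym (length-filter-split (λ u → T? (p v u)) U)) ⟩
    suc r + length (filter (λ u → ¬? (T? (p v u))) U) ∎))
  where
  open ≤-Reasoning
  r : ℕ
  r = length (sel (p v) U)
... | inj₁ (K , K⊆ , len , reds)  = inj₁ (K , v ∷ʳ ⊆-trans K⊆ (filter-⊆ _ U) , len , reds)
... | inj₂ (K , K⊆ , len , blues) = inj₂ (v ∷ K , refl ∷ ⊆-trans K⊆ (filter-⊆ _ U) , cong suc len ,
        SubP.All-resp-⊆ K⊆ (AllP.all-filter (λ u → ¬? (T? (p v u))) U) ∷ blues)

-- The recursion of `branch`: once the first vertex is set aside, one of the `c` colours keeps more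
-- than `treeBound c ℓ` of the remaining ones.
treeBound : ℕ → ℕ → ℕ
treeBound c zero    = 0
treeBound c (suc ℓ) = suc (treeBound c ℓ * c)

treeBound≤^ : ∀ c ℓ → treeBound c ℓ ≤ suc c ^ ℓ
treeBound≤^ c zero    = z≤n
treeBound≤^ c (suc ℓ) = begin
  1 + treeBound c ℓ * c       ≤⟨ +-mono-≤ (m^n>0 (suc c) ℓ) (*-monoˡ-≤ c (treeBound≤^ c ℓ)) ⟩
  suc c ^ ℓ + suc c ^ ℓ * c   ≡⟨ cong (suc c ^ ℓ +_) (*-comm (suc c ^ ℓ) c) ⟩
  suc c ^ suc ℓ               ∎
  where open ≤-Reasoning

-- The Erdős–Szekeres branch: the colour of a pair depends on its first member only.
branch : {A B : Set} (_≟ᴮ_ : DecidableEquality B) (col : A → A → B) (codes : List B) →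
  (∀ v w → col v w ∈ codes) → (ℓ : ℕ) (U : List A) → treeBound (length codes) ℓ < length U →
  ∃ λ (Z : List (B × A)) → length Z ≡ ℓ × map proj₂ Z ⊆ U ×
    AllPairs (λ z w → col (proj₂ z) (proj₂ w) ≡ proj₁ z) Z
branch _≟ᴮ_ col codes col∈ zero    U       _ = [] , refl , minimum U , []
branch _≟ᴮ_ col codes col∈ (suc ℓ) (v ∷ U) (s≤s h)
  with pigeonhole _≟ᴮ_ (col v) (treeBound (length codes) ℓ) codes U (All.universal (col∈ v) U) h
... | c , _ , big with branch _≟ᴮ_ col codes col∈ ℓ (filter (λ w → col v w ≟ᴮ c) U) big
...   | Z , len , Z⊆ , pairs = (c , v) ∷ Z , cong suc len , refl ∷ ⊆-trans Z⊆ (filter-⊆ _ U) ,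
        AllP.map⁻ (SubP.All-resp-⊆ Z⊆ (AllP.all-filter (λ w → col v w ≟ᴮ c) U)) ∷ pairs

justs : {A B : Set} → List (Maybe B × A) → List (B × A)
justs []                = []
justs ((nothing , x) ∷ Z) = justs Z
justs ((just i  , x) ∷ Z) = (i , x) ∷ justs Z

nothings : {A B : Set} → List (Maybe B × A) → List A
nothings []                = []
nothings ((nothing , x) ∷ Z) = x ∷ nothings Z
nothings ((just i  , x) ∷ Z) = nothings Z

length-nothings+justs : {A B : Set} (Z : List (Maybe B × A)) → length (nothings Z) + length (justs Z) ≡ length Z
length-nothings+justs []                = refl
length-nothings+justs ((nothing , x) ∷ Z) = cong suc (length-nothings+justs Z)
length-nothings+justs ((just i  , x) ∷ Z) = trans (+-suc _ _) (cong suc (length-nothings+justs Z))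

nothings-⊆ : {A B : Set} (Z : List (Maybe B × A)) → nothings Z ⊆ map proj₂ Z
nothings-⊆ []                = []
nothings-⊆ ((nothing , x) ∷ Z) = refl ∷ nothings-⊆ Z
nothings-⊆ ((just i  , x) ∷ Z) = x ∷ʳ nothings-⊆ Z

justs-⊆ : {A B : Set} (Z : List (Maybe B × A)) → map proj₂ (justs Z) ⊆ map proj₂ Z
justs-⊆ []                = []
justs-⊆ ((nothing , x) ∷ Z) = x ∷ʳ justs-⊆ Z
justs-⊆ ((just i  , x) ∷ Z) = refl ∷ justs-⊆ Z

module _ {A B : Set} (col : A → A → Maybe B) where

  Branch : Maybe B × A → Maybe B × A → Set
  Branch z w = col (proj₂ z) (proj₂ w) ≡ proj₁ z

  nothings-pairs : (Z : List (Maybe B × A)) → AllPairs Branch Z → AllPairs (λ v w → col v w ≡ nothing) (nothings Z)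
  nothings-pairs []                []       = []
  nothings-pairs ((nothing , x) ∷ Z) (p ∷ ps) = SubP.All-resp-⊆ (nothings-⊆ Z) (AllP.map⁺ p) ∷ nothings-pairs Z ps
  nothings-pairs ((just i  , x) ∷ Z) (p ∷ ps) = nothings-pairs Z ps

  justs-pairs : (Z : List (Maybe B × A)) → AllPairs Branch Z →
    AllPairs (λ z w → col (proj₂ z) (proj₂ w) ≡ just (proj₁ z)) (justs Z)
  justs-pairs []                []       = []
  justs-pairs ((nothing , x) ∷ Z) (p ∷ ps) = justs-pairs Z ps
  justs-pairs ((just i  , x) ∷ Z) (p ∷ ps) = AllP.map⁻ (SubP.All-resp-⊆ (justs-⊆ Z) (AllP.map⁺ p)) ∷ justs-pairs Z ps

label-class : {A B : Set} (_≟ᴮ_ : DecidableEquality B) (R : B → A → A → Set) (m : ℕ) (codes : List B) (Z : List (B × A)) →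
  All (λ z → proj₁ z ∈ codes) Z → m * length codes < length Z →
  AllPairs (λ z w → proj₁ z ≡ proj₁ w → R (proj₁ z) (proj₂ z) (proj₂ w)) Z →
  ∃ λ c → c ∈ codes × ∃ λ K → length K ≡ m × K ⊆ map proj₂ Z × AllPairs (R c) K
label-class {A} {B} _≟ᴮ_ R m codes Z all big pairs with pigeonhole _≟ᴮ_ proj₁ m codes Z all big
... | c , c∈ , h = c , c∈ , map proj₂ Y , len ,
      SubP.map⁺ proj₂ Y⊆ , AllPairsP.map⁺ (go Y tags (AllPairs-resp-⊆ Y⊆ pairs))
  where
  P? : (z : B × A) → Dec (proj₁ z ≡ c)
  P? z = proj₁ z ≟ᴮ c
  Y = take m (filter P? Z)
  Y⊆ : Y ⊆ Z
  Y⊆ = ⊆-trans (SubP.take-⊆ m (filter P? Z)) (filter-⊆ P? Z)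
  tags : All (λ z → proj₁ z ≡ c) Y
  tags = AllP.take⁺ m (AllP.all-filter P? Z)
  len : length (map proj₂ Y) ≡ m
  len = trans (ListP.length-map proj₂ Y) (trans (ListP.length-take m (filter P? Z)) (m≤n⇒m⊓n≡m (<⇒≤ h)))
  go : (Y : List (B × A)) → All (λ z → proj₁ z ≡ c) Y →
    AllPairs (λ z w → proj₁ z ≡ proj₁ w → R (proj₁ z) (proj₂ z) (proj₂ w)) Y →
    AllPairs (λ z w → R c (proj₂ z) (proj₂ w)) Y
  go []      _          _        = []
  go (z ∷ Y) (refl ∷ e) (p ∷ ps) = All.zipWith (λ { (f , e′) → f (sym e′) }) (p , e) ∷ go Y e ps

-- Low-degree blocks of columns

length-allFin : (n : ℕ) → length (allFin n) ≡ n
length-allFin n = ListP.length-tabulate (λ (i : Fin n) → i)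

length-cartesianProduct : {A B : Set} (L : List A) (M : List B) → length (cartesianProduct L M) ≡ length L * length M
length-cartesianProduct []      M = refl
length-cartesianProduct (x ∷ L) M = trans (ListP.length-++ (map (x ,_) M))
  (cong₂ _+_ (ListP.length-map (x ,_) M) (length-cartesianProduct L M))

∑-⊆ : {A : Set} (f : A → ℕ) {L M : List A} → L ⊆ M → ∑ f L ≤ ∑ f M
∑-⊆ f []         = z≤n
∑-⊆ f (x ∷ʳ s)   = ≤-trans (∑-⊆ f s) (m≤n+m _ (f x))
∑-⊆ f (refl ∷ s) = +-monoʳ-≤ (f _) (∑-⊆ f s)

∑-bound : {A : Set} {f : A → ℕ} {c : ℕ} {L : List A} → All (λ x → f x ≤ c) L → ∑ f L ≤ length L * c
∑-bound {c = c} {L} h = ≤-trans (∑-mono h) (≤-reflexive (∑-const c L))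

f≤∑ : {A : Set} (f : A → ℕ) {x : A} {L : List A} → x ∈ L → f x ≤ ∑ f L
f≤∑ f (here refl) = m≤m+n _ _
f≤∑ f {L = y ∷ L} (there i)   = ≤-trans (f≤∑ f i) (m≤n+m _ (f y))

∑-threshold : {A : Set} {P : A → Set} (P? : ∀ x → Dec (P x)) (f : A → ℕ) (s k : ℕ) →
  (∀ x → ¬ P x → f x ≤ s) → (∀ x → f x ≤ k) → (L : List A) → ∑ f L ≤ s * length L + k * length (filter P? L)
∑-threshold P? f s k small bounded []      = z≤n
∑-threshold P? f s k small bounded (x ∷ L) with P? x
... | yes _ = ≤-trans (+-mono-≤ (bounded x) (∑-threshold P? f s k small bounded L)) (begin
      k + (s * l + k * r)        ≡⟨ lem k (s * l) (k * r) ⟩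
      s * l + (k + k * r)        ≤⟨ +-mono-≤ (*-monoʳ-≤ s (n≤1+n l)) (≤-reflexive (sym (*-suc k r))) ⟩
      s * suc l + k * suc r      ∎)
  where
  open ≤-Reasoning
  l = length L
  r = length (filter P? L)
  lem : ∀ a b c → a + (b + c) ≡ b + (a + c)
  lem = solve-∀
... | no ¬p = ≤-trans (+-mono-≤ (small x ¬p) (∑-threshold P? f s k small bounded L)) (≤-reflexive
      (trans (sym (+-assoc s (s * length L) _)) (cong (_+ k * length (filter P? L)) (sym (*-suc s (length L))))))

T-not : {x : Bool} → T (not x) → ¬ T x
T-not {false} _ ()

unique-remove : {A : Set} (_≟ᴬ_ : DecidableEquality A) (v : A) (L : List A) → Unique L →
  length L ≤ suc (length (filter (λ u → ¬? (v ≟ᴬ u)) L))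
unique-remove _≟ᴬ_ v []      _        = z≤n
unique-remove _≟ᴬ_ v (x ∷ L) (p ∷ ps) with v ≟ᴬ x
... | no _     = s≤s (unique-remove _≟ᴬ_ v L ps)
... | yes refl = s≤s (≤-reflexive (cong length (sym (ListP.filter-all (λ u → ¬? (v ≟ᴬ u)) p))))

few-hits : ∀ q x m t .{{_ : NonZero q}} → q * x ≤ 2 * (8 * m) → 16 * m ≤ q * t → x ≤ t
few-hits q x m t le large = *-cancelˡ-≤ q (≤-trans le (≤-trans (≤-reflexive (sym (*-assoc 2 8 m))) large))

quarter : ∀ g {x u w} → 4 * g < x → x ≤ 2 * u → u ≤ 2 * w → g < w
quarter g {x} {u} {w} big half half′ = *-cancelˡ-< 4 g w (begin-strict
  4 * g          <⟨ big ⟩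
  x              ≤⟨ half ⟩
  2 * u          ≤⟨ *-monoʳ-≤ 2 half′ ⟩
  2 * (2 * w)    ≡⟨ sym (*-assoc 2 2 w) ⟩
  4 * w          ∎)
  where open ≤-Reasoning

budget : ∀ {m x f y} → m < x + suc f → x < y → m < y + f
budget {m} {x} {f} {y} enough longer = ≤-trans enough (≤-trans (≤-reflexive (+-suc x f)) (+-monoˡ-≤ f longer))

-- The first factor pays for the final stage inside one block, the second for
-- `suc (a * (q * b) ^ b)` passes to common neighbourhoods. The base `suc (suc b)` comes from the
-- `suc b` colours of the branch through `treeBound≤^`.
coreBound : (q b a n t : ℕ) → ℕ
coreBound q b a n t =
  suc (4 * (suc (suc b) ^ (a + suc t) * suc (b * n) ^ t)) * suc (q * b * (q * b) ^ b) ^ suc (a * (q * b) ^ b)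

-- A is the set of rows, and the colours are columns, grouped into q blocks of b;
-- h c v u says that the edge between v and u in column c is not blue.
module Core {A : Set} (_≟ᴬ_ : DecidableEquality A) (q′ b a n t : ℕ)
            (h : Fin (suc q′) × Fin b → A → A → Bool)
            (1≤b : 1 ≤ b) (t-large : 16 * (b * b * n) ≤ suc q′ * t) where

  q = suc q′
  C = Fin q × Fin b

  cols : List C
  cols = cartesianProduct (allFin q) (allFin b)

  _≟ᶜ_ : DecidableEquality C
  _≟ᶜ_ = ProdP.≡-dec FinP._≟_ FinP._≟_

  Red Blue : Set
  Red  = ∃ λ (J : List C) → length J ≡ b × Unique J × ∃ λ (K : List A) → length K ≡ a ×
           AllPairs (λ v u → ¬ v ≡ u × All (λ c → T (h c v u)) J) K
  Blue = ∃ λ (c : C) → ∃ λ (K : List A) → length K ≡ n × AllPairs (λ v u → ¬ T (h c v u)) K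

  deg : List A → C → A → ℕ
  deg X c v = ∑ (λ u → 𝟙 (h c v u)) X

  blockDeg : List A → Fin q → A → ℕ
  blockDeg X β v = ∑ (λ i → deg X (β , i) v) (allFin b)

  branchBound : ℕ
  branchBound = treeBound (suc b) (a + suc t)

  -- Labelled blue cliques in one sparse block

  module Block (β : Fin q) where

    hit : A → Fin b × A → Bool
    hit u (i , v) = h (β , i) v u

    hits : List (Fin b × A) → A → ℕ
    hits J u = ∑ (λ z → 𝟙 (hit u z)) J

    -- One blue clique for each column of the block, kept together as a single labelled list; rows
    -- with different labels are unrelated. More than `b * n` entries put at least `n` rows under
    -- one label.
    Independent : List (Fin b × A) → Set
    Independent = AllPairs (λ z w → proj₁ z ≡ proj₁ w → ¬ T (h (β , proj₁ z) (proj₂ z) (proj₂ w)))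

    missed? : ∀ v w → Dec (∃ λ i → ¬ T (h (β , i) v w))
    missed? v w = FinP.any? (λ i → ¬? (T? (h (β , i) v w)))

    -- The Ramsey colouring in `suc b` colours: a column of the block in which the pair is blue, or
    -- `nothing` if it is red in all `b` columns. Hence `a` rows coloured `nothing` give the red
    -- subgrid, and the rows with a label can extend a labelled blue clique.
    missed : A → A → Maybe (Fin b)
    missed v w with missed? v w
    ... | yes (i , _) = just i
    ... | no  _       = nothing

    missed-just : ∀ v w {i} → missed v w ≡ just i → ¬ T (h (β , i) v w)
    missed-just v w e with missed? v w
    missed-just v w refl | yes (i , p) = p

    missed-nothing : ∀ v w → missed v w ≡ nothing → ∀ i → T (h (β , i) v w)
    missed-nothing v w e i with missed? v w
    ... | no np with T? (h (β , i) v w)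
    ...   | yes p = p
    ...   | no ¬p = contradiction (i , ¬p) np

    labels : List (Maybe (Fin b))
    labels = nothing ∷ map just (allFin b)

    missed∈labels : ∀ v w → missed v w ∈ labels
    missed∈labels v w with missed? v w
    ... | yes (i , _) = there (MemP.∈-map⁺ just (∈-allFin i))
    ... | no  _       = here refl

    length-labels : length labels ≡ suc b
    length-labels = cong suc (trans (ListP.length-map just (allFin b)) (length-allFin b))

    block : List C
    block = map (β ,_) (allFin b)

    -- Restricting W to the vertices that avoid a fixed J₀ ⊆ J with |J| ≤ |J₀| + t, more than t
    -- labelled vertices found there can replace the rest of J.
    enlarge : (P : A → Set) (J : List (Fin b × A)) (W : List A) → Unique W → All P W → All (P ∘ proj₂) J →
      Independent J → All (λ u → hits J u ≤ t) W → branchBound * suc (length J) ^ t < length W →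
      Red ⊎ ∃ λ J′ → length J < length J′ × All (P ∘ proj₂) J′ × Independent J′
    enlarge P J W uniqW PW PJ ind few big
      with common-sublist (ProdP.≡-dec FinP._≟_ _≟ᴬ_) (λ u z → not (hit u z)) (length J ∸ t) branchBound J W
             (All.map enough few)
             (≤-<-trans (*-monoʳ-≤ branchBound (length-sublists≤co^ (length J ∸ t) t J (length≤∸+ J))) big)
      where
      length≤∸+ : ∀ (J : List (Fin b × A)) → length J ≤ length J ∸ t + t
      length≤∸+ J = ≤-trans (m≤n+m∸n (length J) t) (≤-reflexive (+-comm t _))
      split : ∀ u (J : List (Fin b × A)) → hits J u + length (sel (λ z → not (hit u z)) J) ≡ length J
      split u []      = refl
      split u (z ∷ J) with hit u z
      ... | true  = cong suc (split u J)
      ... | false = trans (+-suc _ _) (cong suc (split u J))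
      enough : ∀ {u} → hits J u ≤ t → length J ∸ t ≤ length (sel (λ z → not (hit u z)) J)
      enough {u} le = m≤n+o⇒m∸n≤o (length J) t (≤-trans (≤-reflexive (sym (split u J))) (+-monoˡ-≤ _ le))
    ... | J₀ , J₀∈ , U , U⊆ , bigU , avoid
      with branch (MaybeP.≡-dec FinP._≟_) missed labels missed∈labels (a + suc t) U
             (subst (λ z → treeBound z (a + suc t) < length U) (sym length-labels) bigU)
    ...   | Z , lenZ , Z⊆ , pairs with a ≤? length (nothings Z)
    ...     | yes p = inj₁ (block , trans (ListP.length-map (β ,_) (allFin b)) (length-allFin b) ,
                UniqueP.map⁺ (λ { refl → refl }) (UniqueP.allFin⁺ b) ,
                take a (nothings Z) , trans (ListP.length-take a (nothings Z)) (m≤n⇒m⊓n≡m p) ,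
                AllPairs.zipWith (λ { (e , ne) → ne , AllP.map⁺ (All.tabulate (λ {i} _ → missed-nothing _ _ e i)) })
                  ( AllPairs-resp-⊆ (SubP.take-⊆ a (nothings Z)) (nothings-pairs missed Z pairs)
                  , AllPairs-resp-⊆ (⊆-trans (SubP.take-⊆ a (nothings Z)) (⊆-trans (nothings-⊆ Z) (⊆-trans Z⊆ U⊆))) uniqW))
    ...     | no ¬p = inj₂ (J₀ ++ justs Z , longer , AllP.++⁺ (SubP.All-resp-⊆ J₀⊆ PJ) PZ ,
                AllPairsP.++⁺ (AllPairs-resp-⊆ J₀⊆ ind)
                  (AllPairs.map (λ e _ → missed-just _ _ e) (justs-pairs missed Z pairs))
                  (All.tabulate λ z∈ → All.map (λ av → λ { refl → T-not (All.lookup av z∈) }) avoidZ))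
      where
      J₀⊆ = proj₁ (∈sublists⇒⊆ (length J ∸ t) J J₀∈)
      lenJ₀ = proj₂ (∈sublists⇒⊆ (length J ∸ t) J J₀∈)
      PZ : All (P ∘ proj₂) (justs Z)
      PZ = AllP.map⁻ (SubP.All-resp-⊆ (⊆-trans (justs-⊆ Z) (⊆-trans Z⊆ U⊆)) PW)
      avoidZ : All (λ w → All (λ z → T (not (hit (proj₂ w) z))) J₀) (justs Z)
      avoidZ = AllP.map⁻ (SubP.All-resp-⊆ (⊆-trans (justs-⊆ Z) Z⊆) avoid)
      longer : length J < length (J₀ ++ justs Z)
      longer = begin-strict
        length J                           ≤⟨ m≤n+m∸n (length J) t ⟩
        t + (length J ∸ t)                 <⟨ +-monoˡ-< (length J ∸ t) t<justs ⟩
        length (justs Z) + (length J ∸ t)  ≡⟨ +-comm (length (justs Z)) _ ⟩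
        (length J ∸ t) + length (justs Z)  ≡⟨ cong (_+ length (justs Z)) (sym lenJ₀) ⟩
        length J₀ + length (justs Z)       ≡⟨ sym (ListP.length-++ J₀) ⟩
        length (J₀ ++ justs Z)             ∎
        where
        open ≤-Reasoning
        t<justs : t < length (justs Z)
        t<justs = +-cancelˡ-< (length (nothings Z)) _ _ (begin-strict
          length (nothings Z) + t                  <⟨ +-monoˡ-< t (≰⇒> ¬p) ⟩
          a + t                                    <⟨ +-monoʳ-< a (n<1+n t) ⟩
          a + suc t                                ≡⟨ sym lenZ ⟩
          length Z                                 ≡⟨ sym (length-nothings+justs Z) ⟩
          length (nothings Z) + length (justs Z)   ∎)

    module _ (X U : List A) (uniqX : Unique X) (U⊆X : U ⊆ X) (half : length X ≤ 2 * length U)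
             (low : All (λ v → q * blockDeg X β v ≤ 2 * (2 * b * length X)) U)
             (big : 4 * (branchBound * suc (b * n) ^ t) < length X) where

      Low : A → Set
      Low v = q * blockDeg X β v ≤ 2 * (2 * b * length X)

      -- Double counting: the hits summed over rows are the degrees summed over `J`. Each degree is
      -- at most 4b|X|/q, hence at most 8b|U|/q, and `J` has at most bn members. Markov's inequality
      -- doubles the resulting mean 8b²n/q, which is the origin of the 16 in `t-large`.
      ∑hits : (J : List (Fin b × A)) → All (Low ∘ proj₂) J → length J ≤ b * n →
              ∑ (λ u → q * hits J u) U ≤ 8 * (b * b * n) * length U
      ∑hits J lowJ short = begin
        ∑ (λ u → q * hits J u) U                     ≡⟨ ∑-*ˡ q (hits J) U ⟩
        q * ∑ (hits J) U                             ≤⟨ *-monoʳ-≤ q (∑-⊆ (hits J) U⊆X) ⟩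
        q * ∑ (hits J) X                             ≡⟨ cong (q *_) (∑-swap (λ u z → 𝟙 (hit u z)) X J) ⟩
        q * ∑ (λ z → deg X (β , proj₁ z) (proj₂ z)) J ≡⟨ sym (∑-*ˡ q _ J) ⟩
        ∑ (λ z → q * deg X (β , proj₁ z) (proj₂ z)) J ≤⟨ ∑-bound (All.map (λ {z} lo → ≤-trans
             (*-monoʳ-≤ q (f≤∑ (λ i → deg X (β , i) (proj₂ z)) (∈-allFin (proj₁ z)))) lo) lowJ) ⟩
        length J * (2 * (2 * b * length X))          ≤⟨ *-mono-≤ short (*-monoʳ-≤ 2 (*-monoʳ-≤ (2 * b) half)) ⟩
        b * n * (2 * (2 * b * (2 * length U)))       ≡⟨ lem b n (length U) ⟩
        8 * (b * b * n) * length U                   ∎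
        where
        open ≤-Reasoning
        lem : ∀ b n u → b * n * (2 * (2 * b * (2 * u))) ≡ 8 * (b * b * n) * u
        lem = solve-∀

      finish : (J : List (Fin b × A)) → Independent J → b * n < length J → Blue
      finish J ind long with label-class FinP._≟_ (λ i v u → ¬ T (h (β , i) v u)) n (allFin b) J
        (All.universal (λ z → ∈-allFin (proj₁ z)) J)
        (subst (_< length J) (trans (*-comm b n) (cong (n *_) (sym (length-allFin b)))) long) ind
      ... | i , _ , K , lenK , _ , pairs = (β , i) , K , lenK , pairs

      -- Every round lengthens `J`, so `suc (b * n)` rounds make some label occur `n` times unless a
      -- red subgrid turns up earlier. The members of `J` are kept `Low` because the next round
      -- counts hits through their degrees.
      loop : (fuel : ℕ) (J : List (Fin b × A)) → All (Low ∘ proj₂) J → Independent J →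
             b * n < length J + fuel → Red ⊎ Blue
      loop zero J lowJ ind enough = inj₂ (finish J ind (subst (b * n <_) (+-identityʳ (length J)) enough))
      loop (suc fuel) J lowJ ind enough with b * n <? length J
      ... | yes long = inj₂ (finish J ind long)
      ... | no ¬long = continue (enlarge Low J W (AllPairs-resp-⊆ (⊆-trans W⊆U U⊆X) uniqX) (SubP.All-resp-⊆ W⊆U low) lowJ ind few bigW)
        where
        short : length J ≤ b * n
        short = ≮⇒≥ ¬long
        few? : ∀ u → Dec (q * hits J u ≤ 2 * (8 * (b * b * n)))
        few? u = q * hits J u ≤? 2 * (8 * (b * b * n))
        W : List A
        W = filter few? U
        W⊆U : W ⊆ U
        W⊆U = filter-⊆ few? U
        few : All (λ u → hits J u ≤ t) W
        few = All.map (λ {u} le → few-hits q (hits J u) (b * b * n) t le t-large) (AllP.all-filter few? U)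
        bigW : branchBound * suc (length J) ^ t < length W
        bigW = ≤-<-trans (*-monoʳ-≤ branchBound (^-monoˡ-≤ t (s≤s short)))
          (quarter (branchBound * suc (b * n) ^ t) big half
            (Markov (λ u → q * hits J u) (8 * (b * b * n)) U (∑hits J lowJ short)))
        continue : Red ⊎ (∃ λ J′ → length J < length J′ × All (Low ∘ proj₂) J′ × Independent J′) → Red ⊎ Blue
        continue (inj₁ r) = inj₁ r
        continue (inj₂ (J′ , longer , lowJ′ , ind′)) = loop fuel J′ lowJ′ ind′ (budget enough longer)

      block-outcome : Red ⊎ Blue
      block-outcome = loop (suc (b * n)) [] [] [] ≤-refl

  esBound : ℕ
  esBound = 4 * (branchBound * suc (b * n) ^ t)

  -- Two averages in succession: some block carries at most a 1/q share of the total degree, and at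
  -- least half of the rows have at most twice the mean degree in that block.
  stuck-outcome : (X : List A) → Unique X → All (λ v → ∑ (λ c → deg X c v) cols ≤ 2 * b * length X) X →
                  esBound < length X → Red ⊎ Blue
  stuck-outcome X uniqX stuck big with below-average (λ β → ∑ (blockDeg X β) X) zero (Data.List.tabulate Fin.suc)
  ... | β , _ , avg = Block.block-outcome β X U uniqX (filter-⊆ low? X) half (AllP.all-filter low? X) big
    where
    low? : ∀ v → Dec (q * blockDeg X β v ≤ 2 * (2 * b * length X))
    low? v = q * blockDeg X β v ≤? 2 * (2 * b * length X)
    U : List A
    U = filter low? X
    half : length X ≤ 2 * length U
    half = Markov (λ v → q * blockDeg X β v) (2 * b * length X) X (begin
      ∑ (λ v → q * blockDeg X β v) X                  ≡⟨ ∑-*ˡ q (blockDeg X β) X ⟩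
      q * ∑ (blockDeg X β) X                          ≡⟨ cong (_* ∑ (blockDeg X β) X) (sym (length-allFin q)) ⟩
      length (allFin q) * ∑ (blockDeg X β) X          ≤⟨ avg ⟩
      ∑ (λ β → ∑ (blockDeg X β) X) (allFin q)         ≡⟨ ∑-swap (blockDeg X) (allFin q) X ⟩
      ∑ (λ v → ∑ (λ β → blockDeg X β v) (allFin q)) X ≡⟨ ∑-cong (λ v → sym (∑-cartesianProduct (λ c → deg X c v) (allFin q) (allFin b))) X ⟩
      ∑ (λ v → ∑ (λ c → deg X c v) cols) X            ≤⟨ ∑-bound stuck ⟩
      length X * (2 * b * length X)                   ≡⟨ *-comm (length X) _ ⟩
      2 * b * length X * length X                     ∎)
      where open ≤-Reasoning

  -- Passing to common neighbourhoods

  codes : List (List C)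
  codes = sublists b cols

  -- The number of rows to be exceeded when up to `f` passes remain. `esBound` is added at each
  -- level because the process may get stuck there and enter the final stage; the other summand is
  -- the loss of one pass.
  passBound : ℕ → ℕ
  passBound zero    = esBound
  passBound (suc f) = esBound + q * b * (suc (passBound f) * length codes)

  passBound≤ : ∀ f → suc (passBound f) ≤ suc esBound * suc (q * b * length codes) ^ f
  passBound≤ zero    = ≤-reflexive (sym (*-identityʳ (suc esBound)))
  passBound≤ (suc f) = begin
    suc esBound + q * b * (suc (passBound f) * length codes)   ≡⟨ cong (suc esBound +_) (lem (q * b) (suc (passBound f)) (length codes)) ⟩
    suc esBound + m * suc (passBound f)                        ≤⟨ +-mono-≤ (m≤m*n (suc esBound) (suc m ^ f) {{>-nonZero (m^n>0 (suc m) f)}}) (*-monoʳ-≤ m (passBound≤ f)) ⟩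
    suc esBound * suc m ^ f + m * (suc esBound * suc m ^ f)    ≡⟨ lem′ (suc esBound) (suc m ^ f) m ⟩
    suc esBound * (suc m * suc m ^ f)                          ∎
    where
    open ≤-Reasoning
    m = q * b * length codes
    lem : ∀ k p c → k * (p * c) ≡ k * c * p
    lem = solve-∀
    lem′ : ∀ e p m → e * p + m * (e * p) ≡ e * ((1 + m) * p)
    lem′ = solve-∀

  common : List C → A → A → Set
  common J v u = ¬ v ≡ u × All (λ c → T (h c v u)) J

  -- Rows joined to `v` in fewer than `b` columns contribute at most b|X| to the degree sum of `v`,
  -- so the rest of it falls on rows of `W`, each counted at most q b times. Thus |X| < q |W|, and a
  -- pigeonhole over the `b`-sets of columns follows. The `suc` in `suc m` allows for the loss of
  -- `v` itself.
  pass : (v : A) (X : List A) (m : ℕ) → Unique X → 2 * b * length X < ∑ (λ c → deg X c v) cols →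
         q * b * (suc m * length codes) < length X →
         ∃ λ J → J ∈ codes × ∃ λ X′ → X′ ⊆ X × m < length X′ × All (common J v) X′
  pass v X m uniqX dense big = remove-v (common-sublist _≟ᶜ_ (λ u c → h c v u) b (suc m) cols W (AllP.all-filter rich? X) bigW)
    where
    cnt : A → ℕ
    cnt u = ∑ (λ c → 𝟙 (h c v u)) cols
    rich? : ∀ u → Dec (b ≤ length (sel (λ c → h c v u) cols))
    rich? u = b ≤? length (sel (λ c → h c v u) cols)
    W : List A
    W = filter rich? X
    cnt≤ : ∀ u → length (sel (λ c → h c v u) cols) ≤ q * b
    cnt≤ u = ≤-trans (length-mono-≤ (filter-⊆ (λ c → T? (h c v u)) cols)) (≤-reflexive
      (trans (length-cartesianProduct (allFin q) (allFin b)) (cong₂ _*_ (length-allFin q) (length-allFin b))))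
    ∑rich : ∑ cnt X ≤ b * length X + q * b * length W
    ∑rich = ≤-trans (≤-reflexive (∑-cong (λ u → sym (length-sel (λ c → h c v u) cols)) X))
      (∑-threshold rich? (λ u → length (sel (λ c → h c v u) cols)) b (q * b) (λ u ¬r → <⇒≤ (≰⇒> ¬r)) cnt≤ X)
    bigW : suc m * length codes < length W
    bigW = *-cancelˡ-< (q * b) _ _ (begin-strict
      q * b * (suc m * length codes)  <⟨ big ⟩
      length X                        ≤⟨ m≤n*m (length X) b {{>-nonZero 1≤b}} ⟩
      b * length X                    ≤⟨ <⇒≤ (+-cancelˡ-< (b * length X) _ _ (begin-strict
        b * length X + b * length X           ≡⟨ lem b (length X) ⟩
        2 * b * length X                      <⟨ dense ⟩
        ∑ (λ c → deg X c v) cols              ≡⟨ ∑-swap (λ c u → 𝟙 (h c v u)) cols X ⟩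
        ∑ cnt X                               ≤⟨ ∑rich ⟩
        b * length X + q * b * length W       ∎)) ⟩
      q * b * length W                ∎)
      where
      open ≤-Reasoning
      lem : ∀ b x → b * x + b * x ≡ 2 * b * x
      lem = solve-∀
    v≢? : ∀ u → Dec (¬ v ≡ u)
    v≢? u = ¬? (v ≟ᴬ u)
    remove-v : (∃ λ J → J ∈ codes × ∃ λ U → U ⊆ W × suc m < length U × All (λ u → All (λ c → T (h c v u)) J) U) →
               ∃ λ J → J ∈ codes × ∃ λ X′ → X′ ⊆ X × m < length X′ × All (common J v) X′
    remove-v (J , J∈ , U , U⊆ , bigU , all) = J , J∈ , filter v≢? U , ⊆-trans (filter-⊆ v≢? U) U⊆X ,
        ≤-pred (≤-trans bigU (unique-remove _≟ᴬ_ v U (AllPairs-resp-⊆ U⊆X uniqX))) ,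
        All.zipWith id (AllP.all-filter v≢? U , AllP.filter⁺ v≢? all)
      where
      U⊆X : U ⊆ X
      U⊆X = ⊆-trans U⊆ (filter-⊆ rich? X)

  -- The records (J , v) kept in Z: all of X lies in the common neighbourhood of v in the columns J.
  outcome : (f : ℕ) (X : List A) (Z : List (List C × A)) → Unique X → passBound f < length X →
    a * length codes < length Z + f → All (λ z → proj₁ z ∈ codes) Z →
    AllPairs (λ z w → proj₁ z ≡ proj₁ w → common (proj₁ z) (proj₂ z) (proj₂ w)) Z →
    All (λ u → All (λ z → common (proj₁ z) (proj₂ z) u) Z) X → Red ⊎ Blue
  -- With more than `a * length codes` records some column set occurs at least `a` times, and of its
  -- rows each lies in the common neighbourhoods of the earlier ones.
  outcome zero X Z uniqX big many tags pairs inv =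
    red-class (label-class (ListP.≡-dec _≟ᶜ_) common a codes Z tags (subst (_ <_) (+-identityʳ (length Z)) many) pairs)
    where
    red-class : (∃ λ J → J ∈ codes × ∃ λ K → length K ≡ a × K ⊆ map proj₂ Z × AllPairs (common J) K) → Red ⊎ Blue
    red-class (J , J∈ , K , lenK , _ , pairsK) = inj₁ (J , proj₂ (∈sublists⇒⊆ b cols J∈) ,
      AllPairs-resp-⊆ (proj₁ (∈sublists⇒⊆ b cols J∈)) (UniqueP.cartesianProduct⁺ (UniqueP.allFin⁺ q) (UniqueP.allFin⁺ b)) ,
      K , lenK , pairsK)
  outcome (suc f) X Z uniqX big many tags pairs inv = by-cases (All.all? sparse? X)
    where
    sparse? : ∀ v → Dec (∑ (λ c → deg X c v) cols ≤ 2 * b * length X)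
    sparse? v = ∑ (λ c → deg X c v) cols ≤? 2 * b * length X
    record-pass : (v : A) → v ∈ X →
      (∃ λ J → J ∈ codes × ∃ λ X′ → X′ ⊆ X × passBound f < length X′ × All (common J v) X′) → Red ⊎ Blue
    record-pass v v∈ (J , J∈ , X′ , X′⊆ , big′ , new) =
      outcome f X′ (Z ++ (J , v) ∷ []) (AllPairs-resp-⊆ X′⊆ uniqX) big′
        (subst (a * length codes <_) (sym (trans (cong (_+ f) (ListP.length-++ Z)) (+-assoc (length Z) 1 f))) many)
        (AllP.++⁺ tags (J∈ ∷ []))
        (AllPairsP.++⁺ pairs ([] ∷ []) (All.map (λ c → (λ _ → c) ∷ []) (All.lookup inv v∈)))
        (All.zipWith (λ { (old , c) → AllP.++⁺ old (c ∷ []) }) (SubP.All-resp-⊆ X′⊆ inv , new))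
    by-cases : Dec (All (λ v → ∑ (λ c → deg X c v) cols ≤ 2 * b * length X) X) → Red ⊎ Blue
    by-cases (yes stuck) = stuck-outcome X uniqX stuck (≤-<-trans (m≤m+n esBound _) big)
    by-cases (no ¬stuck) =
      let (v , v∈ , dense) = find (AllP.¬All⇒Any¬ sparse? X ¬stuck)
      in record-pass v v∈ (pass v X (passBound f) uniqX (≰⇒> dense) (≤-<-trans (m≤n+m _ esBound) big))

  grid-or-blue : (X : List A) → Unique X → passBound (suc (a * length codes)) < length X → Red ⊎ Blue
  grid-or-blue X uniqX big = outcome (suc (a * length codes)) X [] uniqX big (n<1+n _) [] [] (All.universal (λ _ → []) X)

  passBound<coreBound : passBound (suc (a * length codes)) < coreBound q b a n t
  passBound<coreBound = begin
    suc (passBound (suc (a * length codes)))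
      ≤⟨ passBound≤ (suc (a * length codes)) ⟩
    suc esBound * suc (q * b * length codes) ^ suc (a * length codes)
      ≤⟨ *-mono-≤ (s≤s (*-monoʳ-≤ 4 (*-monoˡ-≤ (suc (b * n) ^ t) (treeBound≤^ (suc b) (a + suc t)))))
           (≤-trans (^-monoˡ-≤ (suc (a * length codes)) (s≤s (*-monoʳ-≤ (q * b) codes≤)))
                    (^-monoʳ-≤ (suc (q * b * (q * b) ^ b)) (s≤s (*-monoʳ-≤ a codes≤)))) ⟩
    coreBound q b a n t ∎
    where
    open ≤-Reasoning
    codes≤ : length codes ≤ (q * b) ^ b
    codes≤ = ≤-trans (length-sublists≤^ b cols) (≤-reflexive (cong (_^ b)
      (trans (length-cartesianProduct (allFin q) (allFin b)) (cong₂ _*_ (length-allFin q) (length-allFin b)))))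

  core-outcome : (X : List A) → Unique X → coreBound q b a n t ≤ length X → Red ⊎ Blue
  core-outcome X uniqX big = grid-or-blue X uniqX (≤-trans passBound<coreBound big)

-- Red subgrids and blue cliques in large grids

lookup-pairs : {A : Set} {R : A → A → Set} (K : List A) → AllPairs R K → (i j : Fin (length K)) → ¬ i ≡ j →
  R (lookup K i) (lookup K j) ⊎ R (lookup K j) (lookup K i)
lookup-pairs (x ∷ K) (p ∷ ps) zero    zero    ne = contradiction refl ne
lookup-pairs (x ∷ K) (p ∷ ps) zero    (suc j) ne = inj₁ (All.lookup p (MemP.∈-lookup j))
lookup-pairs (x ∷ K) (p ∷ ps) (suc i) zero    ne = inj₂ (All.lookup p (MemP.∈-lookup i))
lookup-pairs (x ∷ K) (p ∷ ps) (suc i) (suc j) ne = lookup-pairs K ps i j (ne ∘ cong suc)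

enumerate : {A : Set} {R : A → A → Set} {m : ℕ} (K : List A) → length K ≡ m → AllPairs R K →
  ∃ λ (g : Fin m → A) → (∀ i → g i ∈ K) × (∀ i j → ¬ i ≡ j → R (g i) (g j) ⊎ R (g j) (g i))
enumerate K refl pairs = lookup K , MemP.∈-lookup , lookup-pairs K pairs

separating⇒injective : {A : Set} {m : ℕ} (g : Fin m → A) → (∀ i j → ¬ i ≡ j → ¬ g i ≡ g j) → Injective _≡_ _≡_ g
separating⇒injective g sep {i} {j} e with i FinP.≟ j
... | yes p = p
... | no ¬p = contradiction e (sep i j ¬p)

lookup-injective : {A : Set} (K : List A) → Unique K → Injective _≡_ _≡_ (lookup K)
lookup-injective K uniq = separating⇒injective (lookup K) λ i j ne e → sep e (lookup-pairs K uniq i j ne)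
  where
  sep : ∀ {x y} → x ≡ y → ¬ (¬ x ≡ y ⊎ ¬ y ≡ x)
  sep e (inj₁ p) = p e
  sep e (inj₂ p) = p (sym e)

isRed : Colour → Bool
isRed red  = true
isRed blue = false

T-isRed : ∀ {c} → T (isRed c) → c ≡ red
T-isRed {red} _ = refl

¬T-isRed : ∀ {c} → ¬ T (isRed c) → c ≡ blue
¬T-isRed {red}  n = ⊥-elim (n tt)
¬T-isRed {blue} _ = refl

module RedOrClique {N : ℕ} (χ : Colouring N) (χ-sym : Symmetric χ) (q′ b a n t : ℕ)
  (1≤b : 1 ≤ b) (t-large : 16 * (b * b * n) ≤ suc q′ * t) where

  module OnColumns {R : ℕ} (row : Fin R → Fin N) (row-inj : Injective _≡_ _≡_ row)
    (col : Fin (suc q′) × Fin b → Fin N) (col-inj : Injective _≡_ _≡_ col)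
    (rows-red : ∀ r c c′ → ¬ c ≡ c′ → χ (row r , col c) (row r , col c′) ≡ red) where

    -- Reflexive by design: a failure of `h` then already says that the two rows are distinct, so
    -- that the lists found for `Blue` enumerate distinct vertices. On the red side distinctness is
    -- carried separately as `¬ v ≡ u`.
    h : Fin (suc q′) × Fin b → Fin R → Fin R → Bool
    h c v u = does (v FinP.≟ u) ∨ isRed (χ (row v , col c) (row u , col c))

    h-red : ∀ c v u → ¬ v ≡ u → T (h c v u) → χ (row v , col c) (row u , col c) ≡ red
    h-red c v u v≢u p with v FinP.≟ u
    ... | yes e = contradiction e v≢u
    ... | no  _ = T-isRed p

    h-blue : ∀ c v u → ¬ T (h c v u) → ¬ v ≡ u × χ (row v , col c) (row u , col c) ≡ blue
    h-blue c v u ¬p with v FinP.≟ u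
    ... | yes e = ⊥-elim (¬p tt)
    ... | no ne = ne , ¬T-isRed ¬p

    open Core FinP._≟_ q′ b a n t h 1≤b t-large public

    red-subgrid : Red → HasRedSubgrid a b χ
    red-subgrid (J , lenJ , uniqJ , K , lenK , pairs) with enumerate J lenJ uniqJ | enumerate K lenK pairs
    ... | y , y∈ , y-sep | x , _ , x-pairs =
          row ∘ x , col ∘ y ,
          (λ e → separating⇒injective x x-sep (row-inj e)) ,
          (λ e → separating⇒injective y y-sep′ (col-inj e)) ,
          straight , λ { i i′ j j′ (inj₁ (ex , ny)) → row-edge i i′ j j′ ex ny
                       ; i i′ j j′ (inj₂ (nx , ey)) → col-edge i i′ j j′ nx ey }
      where
      x-sep : ∀ i j → ¬ i ≡ j → ¬ x i ≡ x j
      x-sep i j ne e with x-pairs i j ne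
      ... | inj₁ (p , _) = p e
      ... | inj₂ (p , _) = p (sym e)
      y-sep′ : ∀ i j → ¬ i ≡ j → ¬ y i ≡ y j
      y-sep′ i j ne e with y-sep i j ne
      ... | inj₁ p = p e
      ... | inj₂ p = p (sym e)
      row-edge : ∀ i i′ j j′ → row (x i) ≡ row (x i′) → ¬ col (y j) ≡ col (y j′) →
                 χ (row (x i) , col (y j)) (row (x i′) , col (y j′)) ≡ red
      row-edge i i′ j j′ ex ny = subst (λ z → χ (row (x i) , col (y j)) (z , col (y j′)) ≡ red) ex
        (rows-red (x i) (y j) (y j′) (ny ∘ cong col))
      col-edge : ∀ i i′ j j′ → ¬ row (x i) ≡ row (x i′) → col (y j) ≡ col (y j′) →
                 χ (row (x i) , col (y j)) (row (x i′) , col (y j′)) ≡ red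
      col-edge i i′ j j′ nx ey = subst (λ z → χ (row (x i) , col (y j)) (row (x i′) , z) ≡ red) ey
        (oriented (x-pairs i i′ (nx ∘ cong (row ∘ x))))
        where
        oriented : common J (x i) (x i′) ⊎ common J (x i′) (x i) →
                   χ (row (x i) , col (y j)) (row (x i′) , col (y j)) ≡ red
        oriented (inj₁ (ne , all)) = h-red (y j) (x i) (x i′) ne (All.lookup all (y∈ j))
        oriented (inj₂ (ne , all)) = trans (χ-sym _ _) (h-red (y j) (x i′) (x i) ne (All.lookup all (y∈ j)))

    blue-clique : Blue → HasBlueClique n χ
    blue-clique (c , K , lenK , pairs) with enumerate K lenK (AllPairs.map (h-blue c _ _) pairs)
    ... | x , _ , x-pairs = (λ i → row (x i) , col c) ,
          (λ e → separating⇒injective x (λ i j ne → proj₁ (edge i j ne)) (row-inj (cong proj₁ e))) ,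
          λ i j ne → inj₂ ((λ e → proj₁ (edge i j ne) (row-inj e)) , refl) , proj₂ (edge i j ne)
      where
      edge : ∀ i j → ¬ i ≡ j → ¬ x i ≡ x j × χ (row (x i) , col c) (row (x j) , col c) ≡ blue
      edge i j ne with x-pairs i j ne
      ... | inj₁ p       = p
      ... | inj₂ (p , e) = p ∘ sym , trans (χ-sym _ _) e

    columns-outcome : coreBound (suc q′) b a n t ≤ R → HasRedSubgrid a b χ ⊎ HasBlueClique n χ
    columns-outcome big with core-outcome (allFin R) (UniqueP.allFin⁺ R) (≤-trans big (≤-reflexive (sym (length-allFin R))))
    ... | inj₁ r = inj₁ (red-subgrid r)
    ... | inj₂ s = inj₂ (blue-clique s)

∀-or : {n : ℕ} {P : Fin n → Set} {B : Set} → (∀ i → P i ⊎ B) → (∀ i → P i) ⊎ B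
∀-or {zero}  f = inj₁ λ ()
∀-or {suc n} f with f zero | ∀-or (f ∘ suc)
... | inj₂ y | _      = inj₂ y
... | inj₁ _ | inj₂ y = inj₂ y
... | inj₁ x | inj₁ g = inj₁ λ { zero → x ; (suc i) → g i }

cast-injective : {k k′ : ℕ} (eq : k ≡ k′) {i j : Fin k} → Fin.cast eq i ≡ Fin.cast eq j → i ≡ j
cast-injective eq {i} {j} e = FinP.toℕ-injective (trans (sym (FinP.toℕ-cast eq i)) (trans (cong toℕ e) (FinP.toℕ-cast eq j)))

-- All rows look for their red `k`-clique among the same `suc n ^ k` columns, which suffice by
-- Ramsey's theorem. So at most `(suc n ^ k) ^ k` cliques compete, and more than `coreBound` rows
-- share one of them.
arrows : (q′ b a n t N : ℕ) → 1 ≤ b → 16 * (b * b * n) ≤ suc q′ * t →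
  (let k = suc q′ * b) → suc n ^ k ≤ N → coreBound (suc q′) b a n t * (suc n ^ k) ^ k < N → Arrows a b n N
arrows q′ b a n t N 1≤b t-large M≤N big χ χ-sym = rows-outcome (∀-or per-row)
  where
  k = suc q′ * b
  M = suc n ^ k
  L₀ : List (Fin N)
  L₀ = take M (allFin N)
  lenL₀ : length L₀ ≡ M
  lenL₀ = trans (ListP.length-take M (allFin N)) (m≤n⇒m⊓n≡m (≤-trans M≤N (≤-reflexive (sym (length-allFin N)))))
  uniqL₀ : Unique L₀
  uniqL₀ = UniqueP.take⁺ M (UniqueP.allFin⁺ N)
  RedRow : Fin N → Set
  RedRow x = ∃ λ K → K ⊆ L₀ × length K ≡ k × AllPairs (λ y y′ → T (isRed (χ (x , y) (x , y′)))) K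
  per-row : ∀ x → RedRow x ⊎ HasBlueClique n χ
  per-row x with off-diagonal-Ramsey (λ y y′ → isRed (χ (x , y) (x , y′))) k n L₀ (≤-reflexive (sym lenL₀))
  ... | inj₁ r = inj₁ r
  ... | inj₂ (K , K⊆ , lenK , blues) with enumerate K lenK (AllPairs.zip (AllPairs-resp-⊆ K⊆ uniqL₀ , blues))
  ...   | y , _ , y-pairs = inj₂ ((λ i → x , y i) ,
            (λ e → separating⇒injective y (λ i j ne → proj₁ (edge i j ne)) (cong proj₂ e)) ,
            λ i j ne → inj₁ (refl , proj₁ (edge i j ne)) , proj₂ (edge i j ne))
    where
    edge : ∀ i j → ¬ i ≡ j → ¬ y i ≡ y j × χ (x , y i) (x , y j) ≡ blue
    edge i j ne with y-pairs i j ne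
    ... | inj₁ (p , c) = p , ¬T-isRed c
    ... | inj₂ (p , c) = p ∘ sym , trans (χ-sym _ _) (¬T-isRed c)
  rows-outcome : (∀ x → RedRow x) ⊎ HasBlueClique n χ → HasRedSubgrid a b χ ⊎ HasBlueClique n χ
  rows-outcome (inj₂ c) = inj₂ c
  rows-outcome (inj₁ clique)
    with pigeonhole (ListP.≡-dec FinP._≟_) (λ x → proj₁ (clique x)) (coreBound (suc q′) b a n t) (sublists k L₀) (allFin N)
      (All.universal (λ x → subst (λ z → proj₁ (clique x) ∈ sublists z L₀) (proj₁ (proj₂ (proj₂ (clique x))))
         (⊆⇒∈sublists (proj₁ (proj₂ (clique x))))) (allFin N))
      (≤-<-trans (*-monoʳ-≤ (coreBound (suc q′) b a n t)
          (≤-trans (length-sublists≤^ k L₀) (≤-reflexive (cong (_^ k) lenL₀))))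
        (≤-trans big (≤-reflexive (sym (length-allFin N)))))
  ... | K , K∈ , bigX with ∈sublists⇒⊆ k L₀ K∈
  ...   | K⊆ , lenK = OnColumns.columns-outcome row row-inj col col-inj rows-red (<⇒≤ bigX)
    where
    open RedOrClique χ χ-sym q′ b a n t 1≤b t-large
    X : List (Fin N)
    X = filter (λ x → ListP.≡-dec FinP._≟_ (proj₁ (clique x)) K) (allFin N)
    row : Fin (length X) → Fin N
    row = lookup X
    row-inj : Injective _≡_ _≡_ row
    row-inj = lookup-injective X (UniqueP.filter⁺ _ (UniqueP.allFin⁺ N))
    index′ : Fin (suc q′) × Fin b → Fin (length K)
    index′ (β , i) = Fin.cast (sym lenK) (combine β i)
    index′-inj : Injective _≡_ _≡_ index′
    index′-inj {β , i} {β′ , i′} e with FinP.combine-injective β i β′ i′ (cast-injective (sym lenK) e)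
    ... | refl , refl = refl
    col : Fin (suc q′) × Fin b → Fin N
    col c = lookup K (index′ c)
    col-inj : Injective _≡_ _≡_ col
    col-inj e = index′-inj (lookup-injective K (AllPairs-resp-⊆ K⊆ uniqL₀) e)
    rows-red : ∀ r c c′ → ¬ c ≡ c′ → χ (row r , col c) (row r , col c′) ≡ red
    rows-red r c c′ ne with lookup-pairs K redK (index′ c) (index′ c′) (ne ∘ index′-inj)
      where
      redK : AllPairs (λ y y′ → T (isRed (χ (row r , y) (row r , y′)))) K
      redK = subst (AllPairs (λ y y′ → T (isRed (χ (row r , y) (row r , y′)))))
        (All.lookup (AllP.all-filter (λ x → ListP.≡-dec FinP._≟_ (proj₁ (clique x)) K) (allFin N)) (MemP.∈-lookup r))
        (proj₂ (proj₂ (proj₂ (clique (row r)))))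
    ... | inj₁ p = T-isRed p
    ... | inj₂ p = trans (χ-sym _ _) (T-isRed p)

-- Size of the upper bound

largest : {P : ℕ → Set} → (∀ k → Dec (P k)) → P 0 → (B : ℕ) → ¬ P B → ∃ λ k → P k × ¬ P (suc k)
largest P? p0 zero    ¬pB = contradiction p0 ¬pB
largest P? p0 (suc B) ¬pB with P? B
... | yes pB  = B , pB , ¬pB
... | no ¬pB′ = largest P? p0 B ¬pB′

m≤m^suc : ∀ m e → m ≤ m ^ suc e
m≤m^suc zero    e = z≤n
m≤m^suc (suc m) e = m≤m*n (suc m) (suc m ^ e) {{>-nonZero (m^n>0 (suc m) e)}}

suc≤2^ : ∀ b → suc b ≤ 2 ^ b
suc≤2^ zero    = ≤-refl
suc≤2^ (suc b) = begin
  2 + b             ≤⟨ s≤s (≤-trans (m≤n+m (suc b) b) (≤-reflexive (+-suc b b))) ⟩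
  suc (suc (b + b)) ≡⟨ lem b ⟩
  2 * suc b         ≤⟨ *-monoʳ-≤ 2 (suc≤2^ b) ⟩
  2 * 2 ^ b         ∎
  where
  open ≤-Reasoning
  lem : ∀ b → suc (suc (b + b)) ≡ 2 * suc b
  lem = solve-∀

^-cancelˡ-≤ : ∀ {x y} e → x ^ suc e ≤ y ^ suc e → x ≤ y
^-cancelˡ-≤ {x} {y} e h with x ≤? y
... | yes p = p
... | no ¬p = contradiction h (<⇒≱ (^-monoˡ-< (suc e) (≰⇒> ¬p)))

^-cancelˡ-< : ∀ {x y} e → x ^ e < y ^ e → x < y
^-cancelˡ-< {x} {y} e h with x <? y
... | yes p = p
... | no ¬p = contradiction (^-monoˡ-≤ e (≮⇒≥ ¬p)) (<⇒≱ h)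

^-distribʳ-* : ∀ e x y → (x * y) ^ e ≡ x ^ e * y ^ e
^-distribʳ-* zero    x y = refl
^-distribʳ-* (suc e) x y rewrite ^-distribʳ-* e x y = lem x y (x ^ e) (y ^ e)
  where
  lem : ∀ x y p r → x * y * (p * r) ≡ x * p * (y * r)
  lem = solve-∀

-- ℓ = ⌊n^{1/m}⌋ and s = ⌊n/ℓ⌋ + 1 are integer substitutes for n^{1/m} and n^{1-1/m}.
record Scale (m′ n : ℕ) : Set where
  field
    q′ s : ℕ
  ℓ : ℕ
  ℓ = suc q′
  field
    n≤ℓs    : n ≤ ℓ * s
    ℓ^m′≤s  : ℓ ^ m′ ≤ s
    ℓ≤n     : ℓ ≤ n
    s^m≤    : s ^ suc m′ ≤ 4 ^ suc m′ * n ^ m′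

scale : ∀ m′ n → 1 ≤ n → Scale m′ n
scale m′ n 1≤n = record { q′ = q′ ; s = s ; n≤ℓs = n≤ℓs ; ℓ^m′≤s = ℓ^m′≤s ; ℓ≤n = ℓ≤n ; s^m≤ = s^m≤ }
  where
  m = suc m′
  root : ∃ λ k → suc k ^ m ≤ n × ¬ suc (suc k) ^ m ≤ n
  root = largest (λ k → suc k ^ m ≤? n) (≤-trans (≤-reflexive (^-zeroˡ m)) 1≤n) n (λ h → <⇒≱ (m≤m^suc (suc n) m′) h)
  q′ = proj₁ root
  ℓ = suc q′
  s = suc (n / ℓ)
  ℓ≤n : ℓ ≤ n
  ℓ≤n = ≤-trans (m≤m^suc ℓ m′) (proj₁ (proj₂ root))
  n≤ℓs : n ≤ ℓ * s
  n≤ℓs = begin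
    n                      ≡⟨ m≡m%n+[m/n]*n n ℓ ⟩
    n % ℓ + n / ℓ * ℓ      ≤⟨ +-monoˡ-≤ (n / ℓ * ℓ) (<⇒≤ (m%n<n n ℓ)) ⟩
    ℓ + n / ℓ * ℓ          ≡⟨ *-comm s ℓ ⟩
    ℓ * s                  ∎
    where open ≤-Reasoning
  sℓ≤2n : s * ℓ ≤ 2 * n
  sℓ≤2n = +-mono-≤ ℓ≤n (≤-trans (m/n*n≤m n ℓ) (≤-reflexive (sym (+-identityʳ n))))
  ℓ^m′≤s : ℓ ^ m′ ≤ s
  ℓ^m′≤s = *-cancelˡ-≤ ℓ (≤-trans (proj₁ (proj₂ root)) n≤ℓs)
  -- One factor 2 of the 4 comes from s ℓ ≤ 2 n, the other from n < (ℓ + 1)^m ≤ (2 ℓ)^m.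
  s^m≤ : s ^ m ≤ 4 ^ m * n ^ m′
  s^m≤ = *-cancelʳ-≤ (s ^ m) (4 ^ m * n ^ m′) n {{>-nonZero 1≤n}} (begin
    s ^ m * n                    ≤⟨ *-monoʳ-≤ (s ^ m) (<⇒≤ (≰⇒> (proj₂ (proj₂ root)))) ⟩
    s ^ m * suc ℓ ^ m            ≤⟨ *-monoʳ-≤ (s ^ m) (^-monoˡ-≤ m 1+ℓ≤2ℓ) ⟩
    s ^ m * (2 * ℓ) ^ m          ≡⟨ sym (^-distribʳ-* m s (2 * ℓ)) ⟩
    (s * (2 * ℓ)) ^ m            ≡⟨ cong (_^ m) (lem s ℓ) ⟩
    (2 * (s * ℓ)) ^ m            ≤⟨ ^-monoˡ-≤ m (*-monoʳ-≤ 2 sℓ≤2n) ⟩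
    (2 * (2 * n)) ^ m            ≡⟨ cong (_^ m) (sym (*-assoc 2 2 n)) ⟩
    (4 * n) ^ m                  ≡⟨ ^-distribʳ-* m 4 n ⟩
    4 ^ m * (n * n ^ m′)         ≡⟨ lem′ (4 ^ m) n (n ^ m′) ⟩
    4 ^ m * n ^ m′ * n           ∎)
    where
    open ≤-Reasoning
    1+ℓ≤2ℓ : suc ℓ ≤ 2 * ℓ
    1+ℓ≤2ℓ = +-mono-≤ {1} {ℓ} (s≤s z≤n) (≤-reflexive (sym (+-identityʳ ℓ)))
    lem : ∀ s l → s * (2 * l) ≡ 2 * (s * l)
    lem = solve-∀
    lem′ : ∀ x y z → x * (y * z) ≡ x * z * y
    lem′ = solve-∀

-- The summands are, in order, the coefficients of `s` in the exponents of n that bound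
-- `suc (4 * _)`, the branch factor, the choice of the members given up, the passes to common
-- neighbourhoods, and the choice of the columns. All are estimated through b ≤ a, since the
-- constant may depend on `a` alone.
upper-exponent : ℕ → ℕ
upper-exponent a = 3 + suc a * (suc a + 16 * (a * a)) + suc a * (16 * (a * a))
  + suc (suc a * suc a) * suc (a * a ^ a) + 2 * (a * a)

module UpperSize (a b n q′ s : ℕ) (2≤b : 2 ≤ b) (b≤a : b ≤ a) (2≤n : 2 ≤ n)
  (ℓ≤n : suc q′ ≤ n) (ℓ²≤s : suc q′ ^ 2 ≤ s) (ℓ^b≤s : suc q′ ^ b ≤ s) where

  open ≤-Reasoning

  instance
    n≢0 : NonZero n
    n≢0 = >-nonZero (≤-trans (s≤s z≤n) 2≤n)
    s≢0 : NonZero s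
    s≢0 = >-nonZero (≤-trans (m^n>0 (suc q′) 2) ℓ²≤s)
    a≢0 : NonZero a
    a≢0 = >-nonZero (≤-trans (s≤s z≤n) (≤-trans 2≤b b≤a))

  ℓ = suc q′
  k = ℓ * b
  -- Chosen so that n ≤ ℓ s yields 16 b² n ≤ ℓ t, the hypothesis `t-large`.
  t = 16 * (b * b) * s

  2^≤n^ : ∀ e → 2 ^ e ≤ n ^ e
  2^≤n^ e = ^-monoˡ-≤ e 2≤n

  suc-b≤ : suc b ≤ n ^ a
  suc-b≤ = ≤-trans (s≤s b≤a) (≤-trans (suc≤2^ a) (2^≤n^ a))

  suc-suc-b≤ : suc (suc b) ≤ n ^ suc a
  suc-suc-b≤ = ≤-trans (s≤s (s≤s b≤a)) (≤-trans (suc≤2^ (suc a)) (2^≤n^ (suc a)))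

  suc-bn≤ : suc (b * n) ≤ n ^ suc a
  suc-bn≤ = begin
    1 + b * n     ≤⟨ +-monoˡ-≤ (b * n) (>-nonZero⁻¹ n) ⟩
    n + b * n     ≤⟨ *-monoˡ-≤ n suc-b≤ ⟩
    n ^ a * n     ≡⟨ *-comm (n ^ a) n ⟩
    n ^ suc a     ∎

  suc-n≤ : suc n ≤ n ^ 2
  suc-n≤ = begin
    1 + n         ≤⟨ +-monoˡ-≤ n (>-nonZero⁻¹ n) ⟩
    n + n         ≡⟨ cong (n +_) (sym (+-identityʳ n)) ⟩
    2 * n         ≤⟨ *-mono-≤ 2≤n (≤-reflexive (sym (*-identityʳ n))) ⟩
    n ^ 2         ∎

  t≤ : t ≤ 16 * (a * a) * s
  t≤ = *-monoˡ-≤ s (*-monoʳ-≤ 16 (*-mono-≤ b≤a b≤a))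

  k²≤ : k * k ≤ a * a * s
  k²≤ = begin
    ℓ * b * (ℓ * b)   ≡⟨ lem ℓ b ⟩
    b * b * ℓ ^ 2     ≤⟨ *-mono-≤ (*-mono-≤ b≤a b≤a) ℓ²≤s ⟩
    a * a * s         ∎
    where
    lem : ∀ l b → l * b * (l * b) ≡ b * b * (l * (l * 1))
    lem = solve-∀

  k^b≤ : k ^ b ≤ a ^ a * s
  k^b≤ = begin
    (ℓ * b) ^ b     ≡⟨ ^-distribʳ-* b ℓ b ⟩
    ℓ ^ b * b ^ b   ≤⟨ *-mono-≤ ℓ^b≤s (≤-trans (^-monoˡ-≤ b b≤a) (^-monoʳ-≤ a b≤a)) ⟩
    s * a ^ a       ≡⟨ *-comm s (a ^ a) ⟩
    a ^ a * s       ∎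

  k≤ : k ≤ n ^ suc a
  k≤ = *-mono-≤ ℓ≤n (≤-trans (n≤1+n b) suc-b≤)

  X≤ : suc (suc b) ^ (a + suc t) * suc (b * n) ^ t ≤ n ^ ((suc a * (suc a + 16 * (a * a)) + suc a * (16 * (a * a))) * s)
  X≤ = begin
    suc (suc b) ^ (a + suc t) * suc (b * n) ^ t
      ≤⟨ *-mono-≤ (^-monoˡ-≤ (a + suc t) suc-suc-b≤) (^-monoˡ-≤ t suc-bn≤) ⟩
    (n ^ suc a) ^ (a + suc t) * (n ^ suc a) ^ t
      ≡⟨ cong₂ _*_ (^-*-assoc n (suc a) (a + suc t)) (^-*-assoc n (suc a) t) ⟩
    n ^ (suc a * (a + suc t)) * n ^ (suc a * t)
      ≡⟨ sym (^-distribˡ-+-* n (suc a * (a + suc t)) (suc a * t)) ⟩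
    n ^ (suc a * (a + suc t) + suc a * t)
      ≤⟨ ^-monoʳ-≤ n (begin
        suc a * (a + suc t) + suc a * t
          ≡⟨ cong (λ z → suc a * z + suc a * t) (+-suc a t) ⟩
        suc a * (suc a + t) + suc a * t
          ≤⟨ +-mono-≤ (*-monoʳ-≤ (suc a) (+-mono-≤ (m≤m*n (suc a) s) t≤)) (*-monoʳ-≤ (suc a) t≤) ⟩
        suc a * (suc a * s + 16 * (a * a) * s) + suc a * (16 * (a * a) * s)
          ≡⟨ lem (suc a) (16 * (a * a)) s ⟩
        (suc a * (suc a + 16 * (a * a)) + suc a * (16 * (a * a))) * s ∎) ⟩
    n ^ ((suc a * (suc a + 16 * (a * a)) + suc a * (16 * (a * a))) * s) ∎
    where
    lem : ∀ a c s → a * (a * s + c * s) + a * (c * s) ≡ (a * (a + c) + a * c) * s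
    lem = solve-∀

  suc≤n* : ∀ {x y} → 1 ≤ y → x ≤ y → suc x ≤ n * y
  suc≤n* {x} {y} 1≤y x≤y = begin
    1 + x     ≤⟨ +-mono-≤ 1≤y x≤y ⟩
    y + y     ≡⟨ cong (y +_) (sym (+-identityʳ y)) ⟩
    2 * y     ≤⟨ *-monoˡ-≤ y 2≤n ⟩
    n * y     ∎

  Y≤ : suc (k * k ^ b) ≤ n ^ suc (suc a * suc a)
  Y≤ = suc≤n* (m^n>0 n (suc a * suc a)) (begin
    k ^ suc b                  ≤⟨ ^-monoˡ-≤ (suc b) k≤ ⟩
    (n ^ suc a) ^ suc b        ≡⟨ ^-*-assoc n (suc a) (suc b) ⟩
    n ^ (suc a * suc b)        ≤⟨ ^-monoʳ-≤ n (*-monoʳ-≤ (suc a) (s≤s b≤a)) ⟩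
    n ^ (suc a * suc a)        ∎)

  e≤ : suc (a * k ^ b) ≤ suc (a * a ^ a) * s
  e≤ = begin
    1 + a * k ^ b            ≤⟨ +-mono-≤ (>-nonZero⁻¹ s) (*-monoʳ-≤ a k^b≤) ⟩
    s + a * (a ^ a * s)      ≡⟨ cong (s +_) (sym (*-assoc a (a ^ a) s)) ⟩
    suc (a * a ^ a) * s      ∎

  columns≤ : (suc n ^ k) ^ k ≤ n ^ (2 * (a * a) * s)
  columns≤ = begin
    (suc n ^ k) ^ k          ≡⟨ ^-*-assoc (suc n) k k ⟩
    suc n ^ (k * k)          ≤⟨ ^-monoˡ-≤ (k * k) suc-n≤ ⟩
    (n ^ 2) ^ (k * k)        ≡⟨ ^-*-assoc n 2 (k * k) ⟩
    n ^ (2 * (k * k))        ≤⟨ ^-monoʳ-≤ n (*-monoʳ-≤ 2 k²≤) ⟩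
    n ^ (2 * (a * a * s))    ≡⟨ cong (n ^_) (sym (*-assoc 2 (a * a) s)) ⟩
    n ^ (2 * (a * a) * s)    ∎

  core≤ : coreBound ℓ b a n t ≤
    n ^ (3 * s + (suc a * (suc a + 16 * (a * a)) + suc a * (16 * (a * a))) * s + suc (suc a * suc a) * (suc (a * a ^ a) * s))
  core≤ = begin
    suc (4 * X) * suc (k * k ^ b) ^ suc (a * k ^ b)
      ≤⟨ *-mono-≤ first second ⟩
    n ^ (3 * s) * n ^ eX * n ^ (eY * (suc (a * a ^ a) * s))
      ≡⟨ cong (_* n ^ (eY * (suc (a * a ^ a) * s))) (sym (^-distribˡ-+-* n (3 * s) eX)) ⟩
    n ^ (3 * s + eX) * n ^ (eY * (suc (a * a ^ a) * s))
      ≡⟨ sym (^-distribˡ-+-* n (3 * s + eX) (eY * (suc (a * a ^ a) * s))) ⟩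
    n ^ (3 * s + eX + eY * (suc (a * a ^ a) * s)) ∎
    where
    X = suc (suc b) ^ (a + suc t) * suc (b * n) ^ t
    eX = (suc a * (suc a + 16 * (a * a)) + suc a * (16 * (a * a))) * s
    eY = suc (suc a * suc a)
    first : suc (4 * X) ≤ n ^ (3 * s) * n ^ eX
    first = begin
      suc (4 * X)              ≤⟨ suc≤n* (≤-trans (m^n>0 n eX) (m≤n*m (n ^ eX) (n ^ 2) {{>-nonZero (m^n>0 n 2)}})) (*-mono-≤ (2^≤n^ 2) X≤) ⟩
      n * (n ^ 2 * n ^ eX)     ≡⟨ sym (*-assoc n (n ^ 2) (n ^ eX)) ⟩
      n ^ 3 * n ^ eX           ≤⟨ *-monoˡ-≤ (n ^ eX) (^-monoʳ-≤ n (m≤m*n 3 s)) ⟩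
      n ^ (3 * s) * n ^ eX     ∎
    second : suc (k * k ^ b) ^ suc (a * k ^ b) ≤ n ^ (eY * (suc (a * a ^ a) * s))
    second = begin
      suc (k * k ^ b) ^ suc (a * k ^ b)   ≤⟨ ^-monoˡ-≤ (suc (a * k ^ b)) Y≤ ⟩
      (n ^ eY) ^ suc (a * k ^ b)          ≡⟨ ^-*-assoc n eY (suc (a * k ^ b)) ⟩
      n ^ (eY * suc (a * k ^ b))          ≤⟨ ^-monoʳ-≤ n (*-monoʳ-≤ eY e≤) ⟩
      n ^ (eY * (suc (a * a ^ a) * s))    ∎

  total≤ : coreBound ℓ b a n t * (suc n ^ k) ^ k ≤ n ^ (upper-exponent a * s)
  total≤ = begin
    coreBound ℓ b a n t * (suc n ^ k) ^ k   ≤⟨ *-mono-≤ core≤ columns≤ ⟩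
    n ^ e₁ * n ^ e₂                          ≡⟨ sym (^-distribˡ-+-* n e₁ e₂) ⟩
    n ^ (e₁ + e₂)                            ≡⟨ cong (n ^_) (lem (suc a * (suc a + 16 * (a * a))) (suc a * (16 * (a * a)))
                                                  (suc (suc a * suc a)) (suc (a * a ^ a)) (2 * (a * a)) s) ⟩
    n ^ (upper-exponent a * s)               ∎
    where
    e₁ = 3 * s + (suc a * (suc a + 16 * (a * a)) + suc a * (16 * (a * a))) * s + suc (suc a * suc a) * (suc (a * a ^ a) * s)
    e₂ = 2 * (a * a) * s
    lem : ∀ x y z w v s → 3 * s + (x + y) * s + z * (w * s) + v * s ≡ (3 + x + y + z * w + v) * s
    lem = solve-∀

  total< : coreBound ℓ b a n t * (suc n ^ k) ^ k < n ^ (suc (upper-exponent a) * s)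
  total< = ≤-<-trans total≤ (^-monoʳ-< n 2≤n (*-monoˡ-< s (n<1+n (upper-exponent a))))

  columns-fit : suc n ^ k ≤ n ^ (suc (upper-exponent a) * s)
  columns-fit = begin
    suc n ^ k                                ≤⟨ m≤m^n ⟩
    (suc n ^ k) ^ k                          ≤⟨ m≤n*m _ (coreBound ℓ b a n t) {{>-nonZero core>0}} ⟩
    coreBound ℓ b a n t * (suc n ^ k) ^ k   ≤⟨ <⇒≤ total< ⟩
    n ^ (suc (upper-exponent a) * s)         ∎
    where
    core>0 : 0 < coreBound ℓ b a n t
    core>0 = ≤-trans (m^n>0 (suc (k * k ^ b)) (suc (a * k ^ b)))
      (m≤n*m _ (suc (4 * (suc (suc b) ^ (a + suc t) * suc (b * n) ^ t))))
    m≤m^n : suc n ^ k ≤ (suc n ^ k) ^ k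
    m≤m^n = ≤-trans (≤-reflexive (sym (^-identityʳ (suc n ^ k))))
      (^-monoʳ-≤ (suc n ^ k) {{m^n≢0 (suc n) k}} (≤-trans (≤-trans (s≤s z≤n) 2≤b) (m≤n*m b ℓ)))

  arrows-power : n ≤ ℓ * s → Arrows a b n (n ^ (suc (upper-exponent a) * s))
  arrows-power n≤ℓs = arrows q′ b a n t (n ^ (suc (upper-exponent a) * s)) (≤-trans (s≤s z≤n) 2≤b) (begin
    16 * (b * b * n)           ≤⟨ *-monoʳ-≤ 16 (*-monoʳ-≤ (b * b) n≤ℓs) ⟩
    16 * (b * b * (ℓ * s))     ≡⟨ lem (b * b) ℓ s ⟩
    ℓ * (16 * (b * b) * s)     ∎) columns-fit total<
    where
    lem : ∀ b l s → 16 * (b * (l * s)) ≡ l * (16 * b * s)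
    lem = solve-∀

-- Here `m′` is m - 1. Together with ℓ^m′ ≤ s the two inequalities give ℓ^b ≤ s, which controls the
-- number of passes, and ℓ^2 ≤ s, which controls the choice of the columns.
m′≥ : ∀ b → 2 ≤ b → ∃ λ m′ → 2 ^ b ≡ suc (suc m′) × b ≤ m′ × 2 ≤ m′
m′≥ b 2≤b with 2 ^ b in eq | 2+≤2^ b 2≤b
  where
  2+≤2^ : ∀ b → 2 ≤ b → 2 + b ≤ 2 ^ b
  2+≤2^ (suc zero) (s≤s ())
  2+≤2^ (suc (suc zero))    _ = ≤-refl
  2+≤2^ (suc (suc (suc c))) _ = begin
    3 + suc (suc c)                 ≤⟨ s≤s (2+≤2^ (suc (suc c)) (s≤s (s≤s z≤n))) ⟩
    1 + 2 ^ suc (suc c)             ≤⟨ +-mono-≤ (m^n>0 2 (suc (suc c))) (≤-reflexive (sym (+-identityʳ _))) ⟩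
    2 * 2 ^ suc (suc c)             ∎
    where open ≤-Reasoning
... | suc (suc m′) | s≤s (s≤s b≤m′) = m′ , refl , b≤m′ , ≤-trans 2≤b b≤m′

-- By hypothesis s is at most 4 n^(m′/m), so the constant 4K absorbs the 4 and the inequality
-- between m-th powers becomes p′ q K s < p q′. As p/q ≤ log N ≤ K s log n, it follows that p′ q K s
-- ≤ q′ q K s log n, and the positive common exponent q K s cancels.
UpperBound-of-≤ : ∀ (b n N s K m′ : ℕ) → 2 ≤ n → 1 ≤ s → 1 ≤ K → 2 ^ b ≡ suc (suc m′) →
  s ^ suc m′ ≤ 4 ^ suc m′ * n ^ m′ → N ≤ n ^ (K * s) → UpperBound (4 * K) 1 b n N
UpperBound-of-≤ b n N s K m′ 2≤n 1≤s 1≤K eq s^m≤ N≤ p q p′ q′ 1≤q 1≤q′ atLeast ineq =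
  ^-cancelˡ-≤′ {{>-nonZero (*-mono-≤ 1≤q (*-mono-≤ 1≤K 1≤s))}} (begin
    (2 ^ p′) ^ (q * (K * s))    ≡⟨ ^-*-assoc 2 p′ (q * (K * s)) ⟩
    2 ^ (p′ * (q * (K * s)))    ≤⟨ ^-monoʳ-≤ 2 (<⇒≤ rational) ⟩
    2 ^ (p * q′)                ≡⟨ sym (^-*-assoc 2 p q′) ⟩
    (2 ^ p) ^ q′                ≤⟨ ^-monoˡ-≤ q′ (≤-trans atLeast (^-monoˡ-≤ q N≤)) ⟩
    ((n ^ (K * s)) ^ q) ^ q′    ≡⟨ trans (cong (_^ q′) (^-*-assoc n (K * s) q)) (^-*-assoc n (K * s * q) q′) ⟩
    n ^ (K * s * q * q′)        ≡⟨ cong (n ^_) (lem (K * s) q q′) ⟩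
    n ^ (q′ * (q * (K * s)))    ≡⟨ sym (^-*-assoc n q′ (q * (K * s))) ⟩
    (n ^ q′) ^ (q * (K * s))    ∎)
  where
  open ≤-Reasoning
  m = suc m′
  ^-cancelˡ-≤′ : ∀ {x y e} .{{_ : NonZero e}} → x ^ e ≤ y ^ e → x ≤ y
  ^-cancelˡ-≤′ {e = suc e} = ^-cancelˡ-≤ e
  lem : ∀ x q r → x * q * r ≡ r * (q * x)
  lem = solve-∀
  ineq′ : (p′ * q * (4 * K)) ^ m * n ^ m′ < (p * 1 * q′) ^ m
  ineq′ = subst (λ z → (p′ * q * (4 * K)) ^ (z ∸ 1) * n ^ (z ∸ 1 ∸ 1) < (p * 1 * q′) ^ (z ∸ 1)) eq ineq
  rational : p′ * (q * (K * s)) < p * q′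
  rational = ^-cancelˡ-< m (begin-strict
    (p′ * (q * (K * s))) ^ m             ≡⟨ cong (_^ m) (lem₁ p′ q K s) ⟩
    (p′ * q * K * s) ^ m                 ≡⟨ ^-distribʳ-* m (p′ * q * K) s ⟩
    (p′ * q * K) ^ m * s ^ m             ≤⟨ *-monoʳ-≤ ((p′ * q * K) ^ m) s^m≤ ⟩
    (p′ * q * K) ^ m * (4 ^ m * n ^ m′)  ≡⟨ sym (*-assoc ((p′ * q * K) ^ m) (4 ^ m) (n ^ m′)) ⟩
    (p′ * q * K) ^ m * 4 ^ m * n ^ m′    ≡⟨ cong (_* n ^ m′) (trans (sym (^-distribʳ-* m (p′ * q * K) 4)) (cong (_^ m) (lem₂ p′ q K))) ⟩
    (p′ * q * (4 * K)) ^ m * n ^ m′      <⟨ ineq′ ⟩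
    (p * 1 * q′) ^ m                     ≡⟨ cong (λ z → (z * q′) ^ m) (*-identityʳ p) ⟩
    (p * q′) ^ m                         ∎)
    where
    lem₁ : ∀ p q k s → p * (q * (k * s)) ≡ p * q * k * s
    lem₁ = solve-∀
    lem₂ : ∀ p q k → p * q * k * 4 ≡ p * q * (4 * k)
    lem₂ = solve-∀

upper-estimate : ∀ a b n → 2 ≤ b → b ≤ a → 2 ≤ n →
  ∃ λ N₀ → Arrows a b n N₀ × (∀ N → N ≤ N₀ → UpperBound (4 * suc (upper-exponent a)) 1 b n N)
upper-estimate a b n 2≤b b≤a 2≤n =
  let (m′ , eq , b≤m′ , 2≤m′) = m′≥ b 2≤b
      open Scale (scale m′ n (≤-trans (s≤s z≤n) 2≤n))
      ℓ²≤s = ≤-trans (^-monoʳ-≤ ℓ 2≤m′) ℓ^m′≤s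
      open UpperSize a b n q′ s 2≤b b≤a 2≤n ℓ≤n ℓ²≤s (≤-trans (^-monoʳ-≤ ℓ b≤m′) ℓ^m′≤s) using (arrows-power)
  in n ^ (suc (upper-exponent a) * s) , arrows-power n≤ℓs ,
     λ N N≤ → UpperBound-of-≤ b n N s (suc (upper-exponent a)) m′ 2≤n (≤-trans (m^n>0 ℓ m′) ℓ^m′≤s) (s≤s z≤n) eq s^m≤ N≤

-- Decidability of the arrow relation

-- The search runs over the finitely many codes of functions. Decoding inverts coding only
-- pointwise, hence the condition that `P` respects pointwise equality.
search-functions : {k r : ℕ} {P : (Fin k → Fin r) → Set} → (∀ f → Dec (P f)) →
  (∀ {f g} → (∀ i → f i ≡ g i) → P f → P g) → Dec (∃ P)
search-functions {k} {r} P? resp = map′ (λ (i , p) → finToFun i , p)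
  (λ (f , p) → funToFin f , resp (λ i → sym (FinP.finToFun-funToFin f i)) p)
  (FinP.any? (λ i → P? (finToFun {r} {k} i)))

injective? : {k r : ℕ} (f : Fin k → Fin r) → Dec (Injective _≡_ _≡_ f)
injective? f = map′ (λ h {i} {j} → h i j) (λ h i j → h)
  (FinP.all? λ i → FinP.all? λ j → (f i FinP.≟ f j) →-dec (i FinP.≟ j))

injective-resp : {A B : Set} {f g : A → B} → (∀ i → f i ≡ g i) → Injective _≡_ _≡_ f → Injective _≡_ _≡_ g
injective-resp e inj {i} {j} h = inj (trans (e i) (trans h (sym (e j))))

_≟ᶜᵒˡ_ : DecidableEquality Colour
red  ≟ᶜᵒˡ red  = yes refl
red  ≟ᶜᵒˡ blue = no λ ()
blue ≟ᶜᵒˡ red  = no λ ()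
blue ≟ᶜᵒˡ blue = yes refl

adj? : {N : ℕ} (u v : Vertex N) → Dec (Adj u v)
adj? (x , y) (x′ , y′) = ((x FinP.≟ x′) ×-dec ¬? (y FinP.≟ y′)) ⊎-dec (¬? (x FinP.≟ x′) ×-dec (y FinP.≟ y′))

module _ {N : ℕ} (χ : Colouring N) where

  RedIfAdj : Vertex N → Vertex N → Set
  RedIfAdj u v = Adj u v → χ u v ≡ red

  RedGrid : {a b : ℕ} → (Fin a → Fin N) → (Fin b → Fin N) → Orientation → Set
  RedGrid {a} {b} X Y o = (i i′ : Fin a) (j j′ : Fin b) → RedIfAdj (place o (X i) (Y j)) (place o (X i′) (Y j′))

  RedGrid-resp : {a b : ℕ} {X X′ : Fin a → Fin N} {Y Y′ : Fin b → Fin N} (o : Orientation) →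
    (∀ i → X i ≡ X′ i) → (∀ j → Y j ≡ Y′ j) → RedGrid X Y o → RedGrid X′ Y′ o
  RedGrid-resp {X = X} {X′} {Y} {Y′} o eX eY r i i′ j j′
    rewrite sym (eX i) | sym (eX i′) | sym (eY j) | sym (eY j′) = r i i′ j j′

  redGrid? : {a b : ℕ} (X : Fin a → Fin N) (Y : Fin b → Fin N) (o : Orientation) → Dec (RedGrid X Y o)
  redGrid? X Y o = FinP.all? λ i → FinP.all? λ i′ → FinP.all? λ j → FinP.all? λ j′ →
    adj? (place o (X i) (Y j)) (place o (X i′) (Y j′)) →-dec (χ _ _ ≟ᶜᵒˡ red)

  oriented? : {P : Orientation → Set} → (∀ o → Dec (P o)) → Dec (∃ P)
  oriented? P? = map′ (λ { (inj₁ p) → straight , p ; (inj₂ p) → swapped , p })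
    (λ { (straight , p) → inj₁ p ; (swapped , p) → inj₂ p }) (P? straight ⊎-dec P? swapped)

  hasRedSubgrid? : (a b : ℕ) → Dec (HasRedSubgrid a b χ)
  hasRedSubgrid? a b = search-functions
    (λ X → search-functions
      (λ Y → injective? X ×-dec injective? Y ×-dec oriented? (redGrid? X Y))
      (λ eY (iX , iY , o , r) → iX , injective-resp eY iY , o , RedGrid-resp o (λ _ → refl) eY r))
    (λ eX (Y , iX , iY , o , r) → Y , injective-resp eX iX , iY , o , RedGrid-resp o eX (λ _ → refl) r)

  BlueCliqueAt : {n : ℕ} → (Fin n → Vertex N) → Set
  BlueCliqueAt {n} g = Injective _≡_ _≡_ g × ((i j : Fin n) → ¬ i ≡ j → Adj (g i) (g j) × χ (g i) (g j) ≡ blue)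

  blueCliqueAt-resp : {n : ℕ} {g g′ : Fin n → Vertex N} → (∀ i → g i ≡ g′ i) → BlueCliqueAt g → BlueCliqueAt g′
  blueCliqueAt-resp {g′ = g′} e (inj , edges) = injective-resp e inj , λ i j ne →
    subst₂ (λ u v → Adj u v × χ u v ≡ blue) (e i) (e j) (edges i j ne)

  blueCliqueAt? : {n : ℕ} (g : Fin n → Vertex N) → Dec (BlueCliqueAt g)
  blueCliqueAt? g =
    map′ (λ h {i} {j} → h i j) (λ h i j → h)
      (FinP.all? λ i → FinP.all? λ j → ProdP.≡-dec FinP._≟_ FinP._≟_ (g i) (g j) →-dec (i FinP.≟ j))
    ×-dec
    (FinP.all? λ i → FinP.all? λ j → ¬? (i FinP.≟ j) →-dec (adj? (g i) (g j) ×-dec (χ (g i) (g j) ≟ᶜᵒˡ blue)))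

  hasBlueClique? : (n : ℕ) → Dec (HasBlueClique n χ)
  hasBlueClique? n = map′ (λ (x , y , c) → (λ i → x i , y i) , c) (λ (g , c) → proj₁ ∘ g , proj₂ ∘ g , c)
    (search-functions
      (λ x → search-functions (λ y → blueCliqueAt? (λ i → x i , y i))
        (λ e → blueCliqueAt-resp (λ i → cong (x i ,_) (e i))))
      (λ e (y , c) → y , blueCliqueAt-resp (λ i → cong (_, y i) (e i)) c))

Unavoidable : (a b n : ℕ) {N : ℕ} → Colouring N → Set
Unavoidable a b n χ = Symmetric χ → HasRedSubgrid a b χ ⊎ HasBlueClique n χ

unavoidable? : (a b n : ℕ) {N : ℕ} (χ : Colouring N) → Dec (Unavoidable a b n χ)
unavoidable? a b n {N} χ = symmetric? →-dec (hasRedSubgrid? χ a b ⊎-dec hasBlueClique? χ n)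
  where
  symmetric? : Dec (Symmetric χ)
  symmetric? = map′ (λ h (x , y) (x′ , y′) → h x y x′ y′) (λ h x y x′ y′ → h (x , y) (x′ , y′))
    (FinP.all? λ x → FinP.all? λ y → FinP.all? λ x′ → FinP.all? λ y′ → χ (x , y) (x′ , y′) ≟ᶜᵒˡ χ (x′ , y′) (x , y))

unavoidable-resp : (a b n : ℕ) {N : ℕ} {χ χ′ : Colouring N} → (∀ u v → χ u v ≡ χ′ u v) →
  Unavoidable a b n χ → Unavoidable a b n χ′
unavoidable-resp a b n {χ = χ} {χ′} e un sym′ with un (λ u v → trans (e u v) (trans (sym′ u v) (sym (e v u))))
... | inj₁ (X , Y , iX , iY , o , r) = inj₁ (X , Y , iX , iY , o , λ i i′ j j′ ad → trans (sym (e _ _)) (r i i′ j j′ ad))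
... | inj₂ (g , inj , c) = inj₂ (g , inj , λ i j ne → proj₁ (c i j ne) , trans (sym (e _ _)) (proj₂ (c i j ne)))

module ColouringCode (N : ℕ) where

  toColour : Fin 2 → Colour
  toColour zero    = red
  toColour (suc _) = blue

  fromColour : Colour → Fin 2
  fromColour red  = zero
  fromColour blue = suc zero

  toColour-fromColour : ∀ c → toColour (fromColour c) ≡ c
  toColour-fromColour red  = refl
  toColour-fromColour blue = refl

  edge : Vertex N → Vertex N → Fin ((N * N) * (N * N))
  edge (x , y) (x′ , y′) = combine (combine x y) (combine x′ y′)

  decode : (Fin ((N * N) * (N * N)) → Fin 2) → Colouring N
  decode f u v = toColour (f (edge u v))

  encode : Colouring N → Fin ((N * N) * (N * N)) → Fin 2
  encode χ e = fromColour (χ (Fin.remQuot N (Fin.quotient (N * N) e)) (Fin.remQuot N (Fin.remainder {N * N} (N * N) e)))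

  decode-encode : ∀ χ u v → decode (encode χ) u v ≡ χ u v
  decode-encode χ (x , y) (x′ , y′) = trans (toColour-fromColour _) (trans
    (cong (λ p → χ (Fin.remQuot N (proj₁ p)) (Fin.remQuot N (proj₂ p)))
      (FinP.remQuot-combine (combine x y) (combine x′ y′)))
    (cong₂ χ (FinP.remQuot-combine x y) (FinP.remQuot-combine x′ y′)))

-- `IsGr` calls for an actual least `N`. A colouring is coded by its values on all pairs of
-- vertices, so `Arrows` is a test over finitely many codes, and a search below the `N₀` of the
-- upper estimate finds the minimum.
arrows? : (a b n N : ℕ) → Dec (Arrows a b n N)
arrows? a b n N = map′
  (λ h χ → unavoidable-resp a b n {χ′ = χ}
    (λ u v → trans (cong toColour (FinP.finToFun-funToFin (encode χ) (edge u v))) (decode-encode χ u v))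
    (h (funToFin (encode χ))))
  (λ h i → h (decode (finToFun i)))
  (FinP.all? λ i → unavoidable? a b n (decode (finToFun i)))
  where open ColouringCode N

least : {P : ℕ → Set} → (∀ k → Dec (P k)) → (B : ℕ) → P B → ∃ λ N → N ≤ B × P N × (∀ M → P M → N ≤ M)
least {P} P? B pB with below B
  where
  below : ∀ B → (∃ λ N → N < B × P N × (∀ M → P M → N ≤ M)) ⊎ (∀ M → P M → B ≤ M)
  below zero    = inj₂ λ _ _ → z≤n
  below (suc B) with below B
  ... | inj₁ (N , N<B , p , min) = inj₁ (N , m<n⇒m<1+n N<B , p , min)
  ... | inj₂ min with P? B
  ...   | yes p = inj₁ (B , ≤-refl , p , min)
  ...   | no ¬p = inj₂ λ M pM → ≤∧≢⇒< (min M pM) λ { refl → ¬p pM }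
... | inj₁ (N , N<B , p , min) = N , <⇒≤ N<B , p , min
... | inj₂ min                 = B , ≤-refl , pB , min

-- A colouring of the larger grid restricts to the smaller one. This turns the failure of the arrow
-- at the single size 2^(t²) into a lower bound for every `N` that satisfies it.
arrows-mono : ∀ {a b n M N} → M ≤ N → Arrows a b n M → Arrows a b n N
arrows-mono {a} {b} {n} {M} {N} M≤N arr χ χ-sym = extend (arr (λ u v → χ (ι₂ u) (ι₂ v)) (λ u v → χ-sym (ι₂ u) (ι₂ v)))
  where
  ι : Fin M → Fin N
  ι i = inject≤ i M≤N
  ι₂ : Vertex M → Vertex N
  ι₂ (x , y) = ι x , ι y
  ι-inj : Injective _≡_ _≡_ ι
  ι-inj = FinP.inject≤-injective M≤N M≤N _ _
  ι₂-inj : Injective _≡_ _≡_ ι₂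
  ι₂-inj e = cong₂ _,_ (ι-inj (cong proj₁ e)) (ι-inj (cong proj₂ e))
  restrict-adj : ∀ u v → Adj (ι₂ u) (ι₂ v) → Adj u v
  restrict-adj u v (inj₁ (e , ne)) = inj₁ (ι-inj e , ne ∘ cong ι)
  restrict-adj u v (inj₂ (ne , e)) = inj₂ (ne ∘ cong ι , ι-inj e)
  extend-adj : ∀ u v → Adj u v → Adj (ι₂ u) (ι₂ v)
  extend-adj u v (inj₁ (e , ne)) = inj₁ (cong ι e , ne ∘ ι-inj)
  extend-adj u v (inj₂ (ne , e)) = inj₂ (ne ∘ ι-inj , cong ι e)
  extend : HasRedSubgrid a b (λ u v → χ (ι₂ u) (ι₂ v)) ⊎ HasBlueClique n (λ u v → χ (ι₂ u) (ι₂ v)) →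
           HasRedSubgrid a b χ ⊎ HasBlueClique n χ
  extend (inj₁ (X , Y , iX , iY , o , r)) = inj₁ (ι ∘ X , ι ∘ Y , iX ∘ ι-inj , iY ∘ ι-inj , o , grid o r)
    where
    grid : ∀ o → RedGrid (λ u v → χ (ι₂ u) (ι₂ v)) X Y o → RedGrid χ (ι ∘ X) (ι ∘ Y) o
    grid straight r i i′ j j′ ad = r i i′ j j′ (restrict-adj _ _ ad)
    grid swapped  r i i′ j j′ ad = r i i′ j j′ (restrict-adj _ _ ad)
  extend (inj₂ (g , inj , c)) = inj₂ (ι₂ ∘ g , inj ∘ ι₂-inj ,
    λ i j ne → extend-adj (g i) (g j) (proj₁ (c i j ne)) , proj₂ (c i j ne))

-- Codes and derandomised colourings

∑-point≤1 : {A : Set} (_≟ᴬ_ : DecidableEquality A) (x : A) (L : List A) → Unique L →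
  ∑ (λ c → 𝟙 (does (x ≟ᴬ c))) L ≤ 1
∑-point≤1 _≟ᴬ_ x []      _        = z≤n
∑-point≤1 _≟ᴬ_ x (c ∷ L) (p ∷ ps) with x ≟ᴬ c
... | no _     = ∑-point≤1 _≟ᴬ_ x L ps
... | yes refl = s≤s (≤-reflexive (absent L p))
  where
  absent : ∀ L → All (λ y → ¬ x ≡ y) L → ∑ (λ c → 𝟙 (does (x ≟ᴬ c))) L ≡ 0
  absent []      _        = refl
  absent (y ∷ L) (q ∷ qs) with x ≟ᴬ y
  ... | yes e = contradiction e q
  ... | no _  = absent L qs

𝟙-yes : {P : Set} (P? : Dec P) → P → 𝟙 (does P?) ≡ 1
𝟙-yes (yes _) _ = refl
𝟙-yes (no ¬p) p = contradiction p ¬p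

agree : {D r : ℕ} → (Fin D → Fin r) → (Fin D → Fin r) → ℕ
agree {zero}  f g = 0
agree {suc D} f g = 𝟙 (does (f zero FinP.≟ g zero)) + agree (f ∘ suc) (g ∘ suc)

agree-sym : {D r : ℕ} (f g : Fin D → Fin r) → agree f g ≡ agree g f
agree-sym {zero}  f g = refl
agree-sym {suc D} f g = cong₂ _+_ head (agree-sym (f ∘ suc) (g ∘ suc))
  where
  head : 𝟙 (does (f zero FinP.≟ g zero)) ≡ 𝟙 (does (g zero FinP.≟ f zero))
  head with f zero FinP.≟ g zero | g zero FinP.≟ f zero
  ... | yes _ | yes _ = refl
  ... | no  _ | no  _ = refl
  ... | yes e | no ne = contradiction (sym e) ne
  ... | no ne | yes e = contradiction (sym e) ne

-- Choosing each symbol as the least popular one, at most doubles the weighted count at every coordinate.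
greedy-word : (r′ D : ℕ) {I : Set} (L : List I) (w : I → Fin D → Fin (suc r′)) (wt : I → ℕ) →
  ∃ λ (v : Fin D → Fin (suc r′)) → ∑ (λ i → wt i * suc r′ ^ agree (w i) v) L ≤ 2 ^ D * ∑ wt L
greedy-word r′ zero    L w wt = (λ ()) , ≤-reflexive (trans (∑-cong (λ i → *-identityʳ (wt i)) L) (sym (+-identityʳ _)))
greedy-word r′ (suc D) L w wt = prepend (below-average popularity zero (tabulate Fin.suc))
  where
  open ≤-Reasoning
  r = suc r′
  same : Fin r → _ → Bool
  same c i = does (w i zero FinP.≟ c)
  popularity : Fin r → ℕ
  popularity c = ∑ (λ i → wt i * 𝟙 (same c i)) L
  total : ∑ popularity (allFin r) ≤ ∑ wt L
  total = begin
    ∑ popularity (allFin r)                                  ≡⟨ ∑-swap (λ c i → wt i * 𝟙 (same c i)) (allFin r) L ⟩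
    ∑ (λ i → ∑ (λ c → wt i * 𝟙 (same c i)) (allFin r)) L     ≡⟨ ∑-cong (λ i → ∑-*ˡ (wt i) (λ c → 𝟙 (same c i)) (allFin r)) L ⟩
    ∑ (λ i → wt i * ∑ (λ c → 𝟙 (same c i)) (allFin r)) L     ≤⟨ ∑-mono (All.universal (λ i →
       *-monoʳ-≤ (wt i) (∑-point≤1 FinP._≟_ (w i zero) (allFin r) (UniqueP.allFin⁺ r))) L) ⟩
    ∑ (λ i → wt i * 1) L                                     ≡⟨ ∑-cong (λ i → *-identityʳ (wt i)) L ⟩
    ∑ wt L                                                   ∎
  reweigh : ∀ x b → x * r ^ 𝟙 b ≤ x + r * (x * 𝟙 b)
  reweigh x true  = ≤-trans (≤-reflexive (lem x r)) (m≤n+m _ x)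
    where
    lem : ∀ x r → x * (r * 1) ≡ r * (x * 1)
    lem = solve-∀
  reweigh x false = ≤-trans (≤-reflexive (*-identityʳ x)) (m≤m+n x _)
  prepend : (∃ λ c → c ∈ allFin r × length (allFin r) * popularity c ≤ ∑ popularity (allFin r)) →
    ∃ λ v → ∑ (λ i → wt i * r ^ agree (w i) v) L ≤ 2 ^ suc D * ∑ wt L
  prepend (c , _ , avg) = v , (begin
    ∑ (λ i → wt i * r ^ agree (w i) v) L                           ≡⟨ ∑-cong (λ i → split (wt i) (𝟙 (same c i)) (agree (w i ∘ suc) v′)) L ⟩
    ∑ (λ i → wt′ i * r ^ agree (w i ∘ suc) v′) L                   ≤⟨ proj₂ rest ⟩
    2 ^ D * ∑ wt′ L                                                ≤⟨ *-monoʳ-≤ (2 ^ D) doubled ⟩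
    2 ^ D * (2 * ∑ wt L)                                           ≡⟨ lem (2 ^ D) (∑ wt L) ⟩
    2 ^ suc D * ∑ wt L                                             ∎)
    where
    wt′ : _ → ℕ
    wt′ i = wt i * r ^ 𝟙 (same c i)
    rest = greedy-word r′ D L (λ i → w i ∘ suc) wt′
    v′ = proj₁ rest
    v : Fin (suc D) → Fin r
    v zero    = c
    v (suc j) = v′ j
    split : ∀ x e e′ → x * r ^ (e + e′) ≡ x * r ^ e * r ^ e′
    split x e e′ = trans (cong (x *_) (^-distribˡ-+-* r e e′)) (sym (*-assoc x (r ^ e) (r ^ e′)))
    lem : ∀ p s → p * (2 * s) ≡ 2 * p * s
    lem = solve-∀
    doubled : ∑ wt′ L ≤ 2 * ∑ wt L
    doubled = begin
      ∑ wt′ L                                                ≤⟨ ∑-mono (All.universal (λ i → reweigh (wt i) (same c i)) L) ⟩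
      ∑ (λ i → wt i + r * (wt i * 𝟙 (same c i))) L           ≡⟨ ∑-+ wt (λ i → r * (wt i * 𝟙 (same c i))) L ⟩
      ∑ wt L + ∑ (λ i → r * (wt i * 𝟙 (same c i))) L         ≡⟨ cong (∑ wt L +_) (∑-*ˡ r (λ i → wt i * 𝟙 (same c i)) L) ⟩
      ∑ wt L + r * popularity c                              ≡⟨ cong (λ z → ∑ wt L + z * popularity c) (sym (length-allFin r)) ⟩
      ∑ wt L + length (allFin r) * popularity c              ≤⟨ +-monoʳ-≤ (∑ wt L) (≤-trans avg total) ⟩
      ∑ wt L + ∑ wt L                                        ≡⟨ cong (∑ wt L +_) (sym (+-identityʳ _)) ⟩
      2 * ∑ wt L                                             ∎

-- A greedy code in the manner of Gilbert and Varshamov. The potential, the sum of r^agree over the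
-- words found so far, is below r^(T + 1) for the word that `greedy-word` supplies; a single word
-- agreeing with it in more than `T` places would already exceed this.
code-words : (r′ D T N : ℕ) → 2 ^ D * N ≤ suc r′ ^ suc T →
  ∃ λ (W : List (Fin D → Fin (suc r′))) → length W ≡ N × AllPairs (λ v w → agree w v ≤ T) W
code-words r′ D T zero    _   = [] , refl , []
code-words r′ D T (suc N) fit with code-words r′ D T N (≤-trans (*-monoʳ-≤ (2 ^ D) (n≤1+n N)) fit)
... | W , lenW , far with greedy-word r′ D W id (λ _ → 1)
...   | v , light = v ∷ W , cong suc lenW , All.tabulate close ∷ far
  where
  open ≤-Reasoning
  light′ : ∑ (λ w → 1 * suc r′ ^ agree w v) W < suc r′ ^ suc T
  light′ = begin-strict
    ∑ (λ w → 1 * suc r′ ^ agree w v) W  ≤⟨ light ⟩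
    2 ^ D * ∑ (λ _ → 1) W               ≡⟨ cong (2 ^ D *_) (trans (∑-const 1 W) (trans (*-identityʳ _) lenW)) ⟩
    2 ^ D * N                           <⟨ *-monoʳ-< (2 ^ D) {{m^n≢0 2 D}} (n<1+n N) ⟩
    2 ^ D * suc N                       ≤⟨ fit ⟩
    suc r′ ^ suc T                      ∎
  close : ∀ {w} → w ∈ W → agree w v ≤ T
  close {w} w∈ with agree w v ≤? T
  ... | yes p = p
  ... | no ¬p = contradiction (≤-trans (^-monoʳ-≤ (suc r′) (≰⇒> ¬p))
                  (≤-trans (≤-reflexive (sym (+-identityʳ _))) (f≤∑ (λ w → 1 * suc r′ ^ agree w v) w∈))) (<⇒≱ light′)

-- The bits of `x` at the places where `f` and `g` agree, in order, padded with zeros to length `T`.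
-- Agreements beyond the first `T` are dropped, which never happens for two words of the code.
restrict : {D r : ℕ} (T : ℕ) (f g : Fin D → Fin r) → (Fin D → Fin 2) → Fin (2 ^ T)
restrict {zero}  T f g x = funToFin {T} (λ _ → zero)
restrict {suc D} T f g x with f zero FinP.≟ g zero
restrict {suc D} zero    f g x | yes _ = zero
restrict {suc D} (suc T) f g x | yes _ = combine (x zero) (restrict T (f ∘ suc) (g ∘ suc) (x ∘ suc))
restrict {suc D} T       f g x | no  _ = restrict T (f ∘ suc) (g ∘ suc) (x ∘ suc)

restrict-injective : {D r : ℕ} (T : ℕ) (f g : Fin D → Fin r) (x x′ : Fin D → Fin 2) → agree f g ≤ T →
  restrict T f g x ≡ restrict T f g x′ → ∀ i → f i ≡ g i → x i ≡ x′ i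
restrict-injective {suc D} T f g x x′ few e i fi≡gi with f zero FinP.≟ g zero
restrict-injective {suc D} (suc T) f g x x′ (s≤s few) e zero    _     | yes _ =
  proj₁ (FinP.combine-injective (x zero) _ (x′ zero) _ e)
restrict-injective {suc D} (suc T) f g x x′ (s≤s few) e (suc i) fi≡gi | yes _ =
  restrict-injective T (f ∘ suc) (g ∘ suc) (x ∘ suc) (x′ ∘ suc) few (proj₂ (FinP.combine-injective (x zero) _ (x′ zero) _ e)) i fi≡gi
restrict-injective {suc D} T f g x x′ few e zero    fi≡gi | no ne = contradiction fi≡gi ne
restrict-injective {suc D} T f g x x′ few e (suc i) fi≡gi | no ne =
  restrict-injective T (f ∘ suc) (g ∘ suc) (x ∘ suc) (x′ ∘ suc) few e i fi≡gi

∑-allFin-suc : {K : ℕ} (f : Fin (suc K) → ℕ) → ∑ f (allFin (suc K)) ≡ f zero + ∑ (f ∘ suc) (allFin K)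
∑-allFin-suc {K} f = cong (f zero +_) (trans (cong (∑ f) (sym (ListP.map-tabulate id Fin.suc))) (∑-map f suc (allFin K)))

injection⇒≤∑ : {P K : ℕ} (g : Fin P → Fin K) → Injective _≡_ _≡_ g → (p : Fin K → Bool) → (∀ i → T (p (g i))) →
  P ≤ ∑ (λ e → 𝟙 (p e)) (allFin K)
injection⇒≤∑ {P} {K} g inj p Tp = begin
  P                                                                 ≡⟨ sym (trans (∑-const 1 (allFin P)) (trans (*-identityʳ _) (length-allFin P))) ⟩
  ∑ (λ _ → 1) (allFin P)                                            ≤⟨ ∑-mono (All.universal at-least (allFin P)) ⟩
  ∑ (λ i → ∑ (λ e → 𝟙 (p e) * 𝟙 (does (e FinP.≟ g i))) (allFin K)) (allFin P) ≡⟨ ∑-swap _ (allFin P) (allFin K) ⟩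
  ∑ (λ e → ∑ (λ i → 𝟙 (p e) * 𝟙 (does (e FinP.≟ g i))) (allFin P)) (allFin K) ≤⟨ ∑-mono (All.universal at-most (allFin K)) ⟩
  ∑ (λ e → 𝟙 (p e)) (allFin K)                                      ∎
  where
  open ≤-Reasoning
  T⇒1 : ∀ {b} → T b → 𝟙 b ≡ 1
  T⇒1 {true} _ = refl
  at-least : ∀ i → 1 ≤ ∑ (λ e → 𝟙 (p e) * 𝟙 (does (e FinP.≟ g i))) (allFin K)
  at-least i = ≤-trans (≤-reflexive (sym (cong₂ _*_ (T⇒1 (Tp i)) (𝟙-yes (g i FinP.≟ g i) refl))))
    (f≤∑ (λ e → 𝟙 (p e) * 𝟙 (does (e FinP.≟ g i))) (∈-allFin (g i)))
  at-most : ∀ e → ∑ (λ i → 𝟙 (p e) * 𝟙 (does (e FinP.≟ g i))) (allFin P) ≤ 𝟙 (p e)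
  at-most e = begin
    ∑ (λ i → 𝟙 (p e) * 𝟙 (does (e FinP.≟ g i))) (allFin P)   ≡⟨ ∑-*ˡ (𝟙 (p e)) _ (allFin P) ⟩
    𝟙 (p e) * ∑ (λ i → 𝟙 (does (e FinP.≟ g i))) (allFin P)   ≡⟨ cong (𝟙 (p e) *_) (sym (∑-map (λ e′ → 𝟙 (does (e FinP.≟ e′))) g (allFin P))) ⟩
    𝟙 (p e) * ∑ (λ e′ → 𝟙 (does (e FinP.≟ e′))) (map g (allFin P)) ≤⟨ *-monoʳ-≤ (𝟙 (p e)) (∑-point≤1 FinP._≟_ e (map g (allFin P)) (UniqueP.map⁺ inj (UniqueP.allFin⁺ P))) ⟩
    𝟙 (p e) * 1                                              ≡⟨ *-identityʳ (𝟙 (p e)) ⟩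
    𝟙 (p e)                                                  ∎

-- Labels that hit all targets

module Hitting (r′ : ℕ) where

  r = suc r′

  weight : {K : ℕ} → (Fin K → Maybe (Fin r)) → ℕ
  weight {zero}  F = 1
  weight {suc K} F = (if is-just (F zero) then r′ else r) * weight (F ∘ suc)

  _≟ᴹ_ : DecidableEquality (Maybe (Fin r))
  _≟ᴹ_ = MaybeP.≡-dec FinP._≟_

  alive : Fin r → Maybe (Fin r) → Bool
  alive c x = not (does (x ≟ᴹ just c))

  ∑-alive : ∀ x → ∑ (λ c → 𝟙 (alive c x)) (allFin r) ≤ (if is-just x then r′ else r)
  ∑-alive nothing  = ≤-reflexive (trans (∑-const 1 (allFin r)) (trans (*-identityʳ _) (length-allFin r)))
  ∑-alive (just x) = ≤-pred (begin
    1 + ∑ (λ c → 𝟙 (alive c (just x))) (allFin r)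
      ≤⟨ +-monoˡ-≤ _ (≤-trans (≤-reflexive (sym (𝟙-yes (just x ≟ᴹ just x) refl))) (f≤∑ (λ c → 𝟙 (does (just x ≟ᴹ just c))) (∈-allFin x))) ⟩
    ∑ (λ c → 𝟙 (does (just x ≟ᴹ just c))) (allFin r) + ∑ (λ c → 𝟙 (alive c (just x))) (allFin r)
      ≡⟨ sym (∑-+ (λ c → 𝟙 (does (just x ≟ᴹ just c))) (λ c → 𝟙 (alive c (just x))) (allFin r)) ⟩
    ∑ (λ c → 𝟙 (does (just x ≟ᴹ just c)) + 𝟙 (alive c (just x))) (allFin r)
      ≡⟨ ∑-cong (λ c → complement (does (just x ≟ᴹ just c))) (allFin r) ⟩
    ∑ (λ _ → 1) (allFin r)
      ≡⟨ trans (∑-const 1 (allFin r)) (trans (*-identityʳ _) (length-allFin r)) ⟩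
    r ∎)
    where
    open ≤-Reasoning
    complement : ∀ b → 𝟙 b + 𝟙 (not b) ≡ 1
    complement true  = refl
    complement false = refl

  Hits : {K : ℕ} → (Fin K → Fin r) → (Fin K → Maybe (Fin r)) → Set
  Hits f F = ∃ λ e → F e ≡ just (f e)

  -- The method of conditional expectations: weight F counts the functions that F does not hit.
  hit-all : (K : ℕ) (Fs : List (Fin K → Maybe (Fin r))) → ∑ weight Fs < r ^ K → ∃ λ f → All (Hits f) Fs
  hit-all zero    []       _        = (λ ()) , []
  hit-all zero    (F ∷ Fs) (s≤s ())
  hit-all (suc K) Fs light = prepend (below-average surviving zero (tabulate Fin.suc))
    where
    open ≤-Reasoning
    surviving : Fin r → ℕ
    surviving c = ∑ (λ F → weight (F ∘ suc)) (sel (λ F → alive c (F zero)) Fs)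
    total : ∑ surviving (allFin r) ≤ ∑ weight Fs
    total = begin
      ∑ surviving (allFin r)
        ≡⟨ ∑-cong (λ c → ∑-sel (λ F → weight (F ∘ suc)) (λ F → alive c (F zero)) Fs) (allFin r) ⟩
      ∑ (λ c → ∑ (λ F → 𝟙 (alive c (F zero)) * weight (F ∘ suc)) Fs) (allFin r)
        ≡⟨ ∑-swap (λ c F → 𝟙 (alive c (F zero)) * weight (F ∘ suc)) (allFin r) Fs ⟩
      ∑ (λ F → ∑ (λ c → 𝟙 (alive c (F zero)) * weight (F ∘ suc)) (allFin r)) Fs
        ≤⟨ ∑-mono (All.universal per-event Fs) ⟩
      ∑ weight Fs ∎
      where
      per-event : ∀ F → ∑ (λ c → 𝟙 (alive c (F zero)) * weight (F ∘ suc)) (allFin r) ≤ weight F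
      per-event F = begin
        ∑ (λ c → 𝟙 (alive c (F zero)) * weight (F ∘ suc)) (allFin r)  ≡⟨ ∑-cong (λ c → *-comm (𝟙 (alive c (F zero))) _) (allFin r) ⟩
        ∑ (λ c → weight (F ∘ suc) * 𝟙 (alive c (F zero))) (allFin r)  ≡⟨ ∑-*ˡ (weight (F ∘ suc)) _ (allFin r) ⟩
        weight (F ∘ suc) * ∑ (λ c → 𝟙 (alive c (F zero))) (allFin r)  ≤⟨ *-monoʳ-≤ (weight (F ∘ suc)) (∑-alive (F zero)) ⟩
        weight (F ∘ suc) * (if is-just (F zero) then r′ else r)       ≡⟨ *-comm (weight (F ∘ suc)) _ ⟩
        weight F                                                      ∎
    prepend : (∃ λ c → c ∈ allFin r × length (allFin r) * surviving c ≤ ∑ surviving (allFin r)) → ∃ λ f → All (Hits f) Fs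
    prepend (c , _ , avg) = f , All.tabulate hit
      where
      Fs′ : List (Fin K → Maybe (Fin r))
      Fs′ = map (λ F → F ∘ suc) (sel (λ F → alive c (F zero)) Fs)
      light′ : ∑ weight Fs′ < r ^ K
      light′ = *-cancelˡ-< r _ _ (begin-strict
        r * ∑ weight Fs′                        ≡⟨ cong (r *_) (∑-map weight (λ F → F ∘ suc) (sel (λ F → alive c (F zero)) Fs)) ⟩
        r * surviving c                         ≡⟨ cong (_* surviving c) (sym (length-allFin r)) ⟩
        length (allFin r) * surviving c         ≤⟨ ≤-trans avg total ⟩
        ∑ weight Fs                             <⟨ light ⟩
        r * r ^ K                               ∎)
      rest = hit-all K Fs′ light′
      f : Fin (suc K) → Fin r
      f zero    = c
      f (suc e) = proj₁ rest e
      hit : ∀ {F} → F ∈ Fs → Hits f F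
      hit {F} F∈ with F zero ≟ᴹ just c
      ... | yes e = zero , e
      ... | no ne = let (e , h) = All.lookup (AllP.map⁻ (proj₂ rest)) (MemP.∈-filter⁺ (λ F → T? (alive c (F zero))) F∈ alive-F)
                    in suc e , h
        where
        alive-F : T (alive c (F zero))
        alive-F with F zero ≟ᴹ just c
        ... | yes e = contradiction e ne
        ... | no _  = tt

  demand : {K : ℕ} → (Fin K → Maybe (Fin r)) → ℕ
  demand F = ∑ (λ e → 𝟙 (is-just (F e))) (allFin _)

  -- Free of division, this says that a uniformly random function misses `F` with probability (1 -
  -- 1/r)^d, where d is `demand F`.
  weight-demand : {K : ℕ} (F : Fin K → Maybe (Fin r)) → weight F * r ^ demand F ≡ r′ ^ demand F * r ^ K
  weight-demand {zero}  F = refl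
  weight-demand {suc K} F rewrite ∑-allFin-suc (λ e → 𝟙 (is-just (F e))) with F zero
  ... | just _  = trans (lem r′ (weight (F ∘ suc)) r (r ^ d)) (trans (cong (λ z → r′ * r * z) (weight-demand (F ∘ suc))) (lem′ r′ r (r′ ^ d) (r ^ K)))
    where
    d = ∑ (λ e → 𝟙 (is-just (F (suc e)))) (allFin K)
    lem : ∀ a w r p → a * w * (r * p) ≡ a * r * (w * p)
    lem = solve-∀
    lem′ : ∀ a r p k → a * r * (p * k) ≡ a * p * (r * k)
    lem′ = solve-∀
  ... | nothing = trans (*-assoc r (weight (F ∘ suc)) _) (trans (cong (r *_) (weight-demand (F ∘ suc))) (lem′ r (r′ ^ d) (r ^ K)))
    where
    d = ∑ (λ e → 𝟙 (is-just (F (suc e)))) (allFin K)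
    lem′ : ∀ r p k → r * (p * k) ≡ p * (r * k)
    lem′ = solve-∀

  weight≤ : {K : ℕ} (P : ℕ) (F : Fin K → Maybe (Fin r)) → P ≤ demand F → weight F * r ^ P ≤ r′ ^ P * r ^ K
  weight≤ {K} P F P≤ with demand F | weight-demand F | m≤n⇒∃[o]m+o≡n P≤
  ... | .(P + d) | eq | d , refl = *-cancelʳ-≤ _ _ (r ^ d) {{m^n≢0 r d}} (begin
    weight F * r ^ P * r ^ d       ≡⟨ *-assoc (weight F) (r ^ P) (r ^ d) ⟩
    weight F * (r ^ P * r ^ d)     ≡⟨ cong (weight F *_) (sym (^-distribˡ-+-* r P d)) ⟩
    weight F * r ^ (P + d)         ≡⟨ eq ⟩
    r′ ^ (P + d) * r ^ K           ≡⟨ cong (_* r ^ K) (^-distribˡ-+-* r′ P d) ⟩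
    r′ ^ P * r′ ^ d * r ^ K        ≤⟨ *-monoˡ-≤ (r ^ K) (*-monoʳ-≤ (r′ ^ P) (^-monoˡ-≤ d (n≤1+n r′))) ⟩
    r′ ^ P * r ^ d * r ^ K         ≡⟨ lem (r′ ^ P) (r ^ d) (r ^ K) ⟩
    r′ ^ P * r ^ K * r ^ d         ∎)
    where
    open ≤-Reasoning
    lem : ∀ x y z → x * y * z ≡ x * z * y
    lem = solve-∀

-- Sorting the ends gives both orders of a pair the same code; labels and targets then depend on the
-- unordered pair, which makes the colouring symmetric.
edge : {N : ℕ} → Fin N → Fin N → Fin (N * N)
edge u v with ≤-total (toℕ u) (toℕ v)
... | inj₁ _ = combine u v
... | inj₂ _ = combine v u

edge-view : {N : ℕ} (u v : Fin N) → edge u v ≡ combine u v ⊎ edge u v ≡ combine v u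
edge-view u v with ≤-total (toℕ u) (toℕ v)
... | inj₁ _ = inj₁ refl
... | inj₂ _ = inj₂ refl

edge-sym : {N : ℕ} (u v : Fin N) → edge u v ≡ edge v u
edge-sym u v with ≤-total (toℕ u) (toℕ v) | ≤-total (toℕ v) (toℕ u)
... | inj₁ _ | inj₂ _ = refl
... | inj₂ _ | inj₁ _ = refl
... | inj₁ p | inj₁ q = cong₂ combine (FinP.≤-antisym p q) (FinP.≤-antisym q p)
... | inj₂ p | inj₂ q = cong₂ combine (FinP.≤-antisym p q) (FinP.≤-antisym q p)

edge-injective : {N : ℕ} (u v u′ v′ : Fin N) → edge u v ≡ edge u′ v′ → (u ≡ u′ × v ≡ v′) ⊎ (u ≡ v′ × v ≡ u′)
edge-injective u v u′ v′ e with edge-view u v | edge-view u′ v′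
... | inj₁ a | inj₁ b = inj₁ (FinP.combine-injective u v u′ v′ (trans (sym a) (trans e b)))
... | inj₁ a | inj₂ b = inj₂ (FinP.combine-injective u v v′ u′ (trans (sym a) (trans e b)))
... | inj₂ a | inj₁ b = inj₂ (swap (FinP.combine-injective v u u′ v′ (trans (sym a) (trans e b))))
... | inj₂ a | inj₂ b = inj₁ (swap (FinP.combine-injective v u v′ u′ (trans (sym a) (trans e b))))

module HittingPairs (r′ N h : ℕ) where
  open Hitting r′

  Tuple : Set
  Tuple = Fin (h + h) → Fin N

  -- Only the pairs between the two halves of the tuple are used. They are plainly distinct and
  -- already number h².
  cross : Tuple → Fin (h * h) → Fin (N * N)
  cross Y p = edge (Y (Fin.quotient h p Fin.↑ˡ h)) (Y (h Fin.↑ʳ Fin.remainder {h} h p))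

  ↑ˡ≢↑ʳ : (i j : Fin h) → ¬ i Fin.↑ˡ h ≡ h Fin.↑ʳ j
  ↑ˡ≢↑ʳ i j e with trans (sym (FinP.splitAt-↑ˡ h i h)) (trans (cong (Fin.splitAt h) e) (FinP.splitAt-↑ʳ h h j))
  ... | ()

  cross-injective : (Y : Tuple) → Injective _≡_ _≡_ Y → Injective _≡_ _≡_ (cross Y)
  cross-injective Y inj {p} {p′} e with edge-injective _ _ _ _ e
  ... | inj₂ (a , _) = contradiction (inj a) (↑ˡ≢↑ʳ _ _)
  ... | inj₁ (a , b) = trans (sym (FinP.combine-remQuot {h} h p)) (trans
          (cong₂ combine (FinP.↑ˡ-injective h _ _ (inj a)) (FinP.↑ʳ-injective h _ _ (inj b)))
          (FinP.combine-remQuot {h} h p′))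

  module _ (τ : Fin N → Fin (N * N) → Fin r) where

    crossed? : (Y : Tuple) (e : Fin (N * N)) → Dec (∃ λ p → cross Y p ≡ e)
    crossed? Y e = FinP.any? (λ p → cross Y p FinP.≟ e)

    -- A labelling that misses `event (x , c)` is off target at every crossing pair of the tuple
    -- `c`, so all these pairs would be blue in the line `x`.
    event : Fin N × Fin (N ^ (h + h)) → Fin (N * N) → Maybe (Fin r)
    event (x , c) e = if does (crossed? (finToFun c) e) then just (τ x e) else nothing

    event-just : ∀ x c e {y} → event (x , c) e ≡ just y → τ x e ≡ y × ∃ λ p → cross (finToFun c) p ≡ e
    event-just x c e eq with crossed? (finToFun c) e
    event-just x c e refl | yes p = refl , p

    event-demand : ∀ x c → Injective _≡_ _≡_ (finToFun {N} {h + h} c) → h * h ≤ demand (event (x , c))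
    event-demand x c inj = injection⇒≤∑ (cross (finToFun c)) (cross-injective _ inj) _ demanded
      where
      demanded : ∀ p → T (is-just (event (x , c) (cross (finToFun c) p)))
      demanded p with crossed? (finToFun c) (cross (finToFun c) p)
      ... | yes _ = tt
      ... | no ne = ne (p , refl)

    codes : List (Fin (N ^ (h + h)))
    codes = filter (λ c → injective? (finToFun {N} {h + h} c)) (allFin _)

    events : List (Fin N × Fin (N ^ (h + h)))
    events = cartesianProduct (allFin N) codes

    length-events : length events ≤ N * N ^ (h + h)
    length-events = ≤-trans (≤-reflexive (length-cartesianProduct (allFin N) codes))
      (*-mono-≤ (≤-reflexive (length-allFin N)) (≤-trans (length-mono-≤ (filter-⊆ _ (allFin (N ^ (h + h))))) (≤-reflexive (length-allFin _))))

    -- A union bound over N lines and at most N^(2h) tuples of distinct vertices, each of whose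
    -- events is missed with probability at most (1 - 1/r)^(h²).
    hit-every-pair-set : N * N ^ (h + h) * r′ ^ (h * h) < r ^ (h * h) →
      ∃ λ (f : Fin (N * N) → Fin r) → ∀ x (Y : Tuple) → Injective _≡_ _≡_ Y →
        ∃ λ i → ∃ λ j → ¬ i ≡ j × f (edge (Y i) (Y j)) ≡ τ x (edge (Y i) (Y j))
    hit-every-pair-set rare = f , hits
      where
      open ≤-Reasoning
      P = h * h
      K = N * N
      bound : All (λ z → weight (event z) * r ^ P ≤ r′ ^ P * r ^ K) events
      bound = All.tabulate λ {z} z∈ → weight≤ P (event z) (event-demand (proj₁ z) (proj₂ z)
        (proj₂ (MemP.∈-filter⁻ (λ c → injective? (finToFun {N} {h + h} c)) {xs = allFin (N ^ (h + h))}
          (proj₂ (MemP.∈-cartesianProduct⁻ (allFin N) codes z∈)))))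
      light : ∑ weight (map event events) < r ^ K
      light = *-cancelˡ-< (r ^ P) _ _ (begin-strict
        r ^ P * ∑ weight (map event events)            ≡⟨ cong (r ^ P *_) (∑-map weight event events) ⟩
        r ^ P * ∑ (λ z → weight (event z)) events      ≡⟨ sym (∑-*ˡ (r ^ P) _ events) ⟩
        ∑ (λ z → r ^ P * weight (event z)) events      ≤⟨ ∑-bound (All.map (λ {z} le → ≤-trans (≤-reflexive (*-comm (r ^ P) (weight (event z)))) le) bound) ⟩
        length events * (r′ ^ P * r ^ K)               ≤⟨ *-monoˡ-≤ (r′ ^ P * r ^ K) length-events ⟩
        N * N ^ (h + h) * (r′ ^ P * r ^ K)             ≡⟨ sym (*-assoc (N * N ^ (h + h)) (r′ ^ P) (r ^ K)) ⟩
        N * N ^ (h + h) * r′ ^ P * r ^ K               <⟨ *-monoˡ-< (r ^ K) {{m^n≢0 r K}} rare ⟩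
        r ^ P * r ^ K                                  ∎)
      found = hit-all K (map event events) light
      f = proj₁ found
      hits : ∀ x (Y : Tuple) → Injective _≡_ _≡_ Y →
        ∃ λ i → ∃ λ j → ¬ i ≡ j × f (edge (Y i) (Y j)) ≡ τ x (edge (Y i) (Y j))
      hits x Y inj = extract (All.lookup (AllP.map⁻ (proj₂ found))
          (MemP.∈-cartesianProduct⁺ (∈-allFin x) (MemP.∈-filter⁺ (λ c → injective? (finToFun {N} {h + h} c)) (∈-allFin c)
            (injective-resp (λ i → sym (same i)) inj))))
        where
        c = funToFin Y
        same : ∀ i → finToFun c i ≡ Y i
        same = FinP.finToFun-funToFin Y
        extract : Hits f (event (x , c)) → ∃ λ i → ∃ λ j → ¬ i ≡ j × f (edge (Y i) (Y j)) ≡ τ x (edge (Y i) (Y j))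
        extract (e , eq) with event-just x c e eq
        ... | hit , p , refl = i , j , ↑ˡ≢↑ʳ _ _ ,
              subst (λ z → f z ≡ τ x z) (cong₂ edge (same i) (same j)) (sym hit)
          where
          i = Fin.quotient h p Fin.↑ˡ h
          j = h Fin.↑ʳ Fin.remainder {h} h p

-- (1 - 1/r)^r ≤ 1/2: the first two terms of the binomial expansion of (r′ + 1)^r are r′^r and r
-- r′^(r - 1), and the second is at least the first.
2*r′^r≤r^r : ∀ r′ → 2 * r′ ^ suc r′ ≤ suc r′ ^ suc r′
2*r′^r≤r^r r′ = begin
  2 * (r′ * r′ ^ r′)                    ≤⟨ ≤-trans (≤-reflexive (lem r′ (r′ ^ r′))) (+-monoʳ-≤ (r′ * r′ ^ r′) (*-monoˡ-≤ (r′ ^ r′) (n≤1+n r′))) ⟩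
  r′ ^ suc r′ + suc r′ * r′ ^ r′        ≤⟨ Bernoulli r′ r′ ⟩
  suc r′ ^ suc r′                       ∎
  where
  open ≤-Reasoning
  lem : ∀ a p → 2 * (a * p) ≡ a * p + a * p
  lem = solve-∀
  Bernoulli : ∀ x k → x ^ suc k + suc k * x ^ k ≤ suc x ^ suc k
  Bernoulli x zero    = ≤-reflexive (lem₀ x)
    where
    lem₀ : ∀ x → x * 1 + 1 * 1 ≡ (1 + x) * 1
    lem₀ = solve-∀
  Bernoulli x (suc k) = begin
    x * (x * x ^ k) + (2 + k) * (x * x ^ k)       ≤⟨ m≤m+n _ ((1 + k) * x ^ k) ⟩
    x * (x * x ^ k) + (2 + k) * (x * x ^ k) + (1 + k) * x ^ k ≡⟨ lem₁ x k (x ^ k) ⟩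
    suc x * (x ^ suc k + suc k * x ^ k)           ≤⟨ *-monoʳ-≤ (suc x) (Bernoulli x k) ⟩
    suc x * suc x ^ suc k                         ∎
    where
    lem₁ : ∀ x k p → x * (x * p) + (2 + k) * (x * p) + (1 + k) * p ≡ (1 + x) * (x * p + (1 + k) * p)
    lem₁ = solve-∀

-- Write h = r g with g = 3D + 1. Then (1 - 1/r)^(h²) ≤ 2^(-g h), while the number of events is at
-- most 2^(D + 2 D h) ≤ 2^(3 D h), short of 2^(g h) by a factor 2^h.
rare-events : ∀ r′ D → (let h = suc r′ * suc (3 * D)) →
  2 ^ D * (2 ^ D) ^ (h + h) * r′ ^ (h * h) < suc r′ ^ (h * h)
rare-events zero     D = ≤-<-trans (≤-reflexive (*-zeroʳ (2 ^ D * (2 ^ D) ^ (h + h)))) (m^n>0 1 (h * h))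
  where
  h = 1 * suc (3 * D)
rare-events r′@(suc _) D = begin-strict
  2 ^ D * (2 ^ D) ^ (h + h) * r′ ^ (h * h)      ≡⟨ cong (_* r′ ^ (h * h)) (trans (cong (2 ^ D *_) (^-*-assoc 2 D (h + h))) (sym (^-distribˡ-+-* 2 D (D * (h + h))))) ⟩
  2 ^ (D + D * (h + h)) * r′ ^ (h * h)          <⟨ *-monoˡ-< (r′ ^ (h * h)) {{m^n≢0 r′ (h * h)}} (^-monoʳ-< 2 (s≤s (s≤s z≤n)) exponent) ⟩
  2 ^ (g * h) * r′ ^ (h * h)                    ≡⟨ cong (2 ^ (g * h) *_) (trans (cong (r′ ^_) (*-assoc r g h)) (sym (^-*-assoc r′ r (g * h)))) ⟩
  2 ^ (g * h) * (r′ ^ r) ^ (g * h)              ≡⟨ sym (^-distribʳ-* (g * h) 2 (r′ ^ r)) ⟩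
  (2 * r′ ^ r) ^ (g * h)                        ≤⟨ ^-monoˡ-≤ (g * h) (2*r′^r≤r^r r′) ⟩
  (r ^ r) ^ (g * h)                             ≡⟨ trans (^-*-assoc r r (g * h)) (cong (r ^_) (sym (*-assoc r g h))) ⟩
  r ^ (h * h)                                   ∎
  where
  open ≤-Reasoning
  r = suc r′
  g = suc (3 * D)
  h = r * g
  exponent : D + D * (h + h) < g * h
  exponent = begin-strict
    D + D * (h + h)          ≤⟨ +-monoˡ-≤ (D * (h + h)) (m≤m*n D h) ⟩
    D * h + D * (h + h)      ≡⟨ lem D h ⟩
    3 * D * h                <⟨ *-monoˡ-< h (n<1+n (3 * D)) ⟩
    g * h                    ∎
    where
    lem : ∀ d h → d * h + d * (h + h) ≡ 3 * d * h
    lem = solve-∀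

-- A colouring without red squares and large blue cliques

funToFin-cong : {k r : ℕ} {f g : Fin k → Fin r} → (∀ i → f i ≡ g i) → funToFin f ≡ funToFin g
funToFin-cong {zero}  e = refl
funToFin-cong {suc k} e = cong₂ combine (e zero) (funToFin-cong (e ∘ suc))

-- Two vertices fix the line. A further vertex joined to both of them across it would have to share
-- with both the coordinate in which they differ.
clique-in-line : {N m : ℕ} (g : Fin m → Vertex N) → (∀ i j → ¬ i ≡ j → Adj (g i) (g j)) → 1 ≤ m →
  (∃ λ x → ∀ i → proj₁ (g i) ≡ x) ⊎ (∃ λ y → ∀ i → proj₂ (g i) ≡ y)
clique-in-line {m = suc zero}    g adj _ = inj₁ (proj₁ (g zero) , λ { zero → refl })
clique-in-line {m = suc (suc m)} g adj _ with adj zero (suc zero) (λ ())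
... | inj₁ (x≡ , y≢) = inj₁ (proj₁ (g zero) , in-row)
  where
  in-row : ∀ i → proj₁ (g i) ≡ proj₁ (g zero)
  in-row zero          = refl
  in-row (suc zero)    = sym x≡
  in-row (suc (suc i)) with adj (suc (suc i)) zero (λ ()) | adj (suc (suc i)) (suc zero) (λ ())
  ... | inj₁ (e , _)  | _              = e
  ... | inj₂ _        | inj₁ (e , _)   = trans e (sym x≡)
  ... | inj₂ (_ , e)  | inj₂ (_ , e′)  = contradiction (trans (sym e) e′) y≢
... | inj₂ (x≢ , y≡) = inj₂ (proj₂ (g zero) , in-col)
  where
  in-col : ∀ i → proj₂ (g i) ≡ proj₂ (g zero)
  in-col zero          = refl
  in-col (suc zero)    = sym y≡
  in-col (suc (suc i)) with adj (suc (suc i)) zero (λ ()) | adj (suc (suc i)) (suc zero) (λ ())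
  ... | inj₂ (_ , e)  | _              = e
  ... | inj₁ _        | inj₂ (_ , e)   = trans e (sym y≡)
  ... | inj₁ (e , _)  | inj₁ (e′ , _)  = contradiction (trans (sym e) e′) x≢

module Avoiding (r′ D T h n : ℕ) (r≡ : 2 ^ T ≡ suc r′) (fit : 2 ^ D * 2 ^ D ≤ suc r′ ^ suc T)
  (rare : 2 ^ D * (2 ^ D) ^ (h + h) * r′ ^ (h * h) < suc r′ ^ (h * h)) (1≤h : 1 ≤ h) (n-large : h + h ≤ n) where

  N r : ℕ
  N = 2 ^ D
  r = suc r′

  abstract
    codebook : ∃ λ (w : Fin N → Fin D → Fin r) → ∀ y y′ → ¬ y ≡ y′ → agree (w y) (w y′) ≤ T
    codebook with code-words r′ D T N fit
    ... | W , lenW , far with enumerate W lenW far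
    ...   | w , _ , w-far = w , λ y y′ ne → either y y′ (w-far y y′ ne)
      where
      either : ∀ y y′ → agree (w y′) (w y) ≤ T ⊎ agree (w y) (w y′) ≤ T → agree (w y) (w y′) ≤ T
      either y y′ (inj₁ p) = ≤-trans (≤-reflexive (agree-sym (w y) (w y′))) p
      either y y′ (inj₂ p) = p

  w : Fin N → Fin D → Fin r
  w = proj₁ codebook

  bits : Fin N → Fin D → Fin 2
  bits = finToFun

  ends : Fin (N * N) → Fin N × Fin N
  ends = Fin.remQuot {N} N

  ends-edge : ∀ u v → ends (edge u v) ≡ (u , v) ⊎ ends (edge u v) ≡ (v , u)
  ends-edge u v with edge-view u v
  ... | inj₁ e = inj₁ (trans (cong ends e) (FinP.remQuot-combine u v))
  ... | inj₂ e = inj₂ (trans (cong ends e) (FinP.remQuot-combine v u))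

  spelled : Fin N → Fin N × Fin N → Fin (2 ^ T)
  spelled x (y , y′) = restrict T (w y) (w y′) (bits x)

  rowTarget : Fin N → Fin (N * N) → Fin r
  rowTarget x e = Fin.cast r≡ (spelled x (ends e))

  differ? : (u v : Fin N) → Dec (∃ λ i → ¬ bits u i ≡ bits v i)
  differ? u v = FinP.any? (λ i → ¬? (bits u i FinP.≟ bits v i))

  symbolAt : {P : Fin D → Set} → Dec (∃ P) → (Fin D → Fin r) → Fin r
  symbolAt (yes (i , _)) f = f i
  symbolAt (no _)        f = zero

  -- The place that is read depends on the pair of rows alone. Two columns with equal symbols
  -- therefore agree at a place where the rows differ.
  symbolOf : Fin N → Fin N × Fin N → Fin r
  symbolOf y (u , v) = symbolAt (differ? u v) (w y)

  colTarget : Fin N → Fin (N * N) → Fin r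
  colTarget y e = symbolOf y (ends e)

  open HittingPairs r′ N h using (hit-every-pair-set)

  abstract
    rowLabels : ∃ λ (f : Fin (N * N) → Fin r) → ∀ x (Y : Fin (h + h) → Fin N) → Injective _≡_ _≡_ Y →
      ∃ λ i → ∃ λ j → ¬ i ≡ j × f (edge (Y i) (Y j)) ≡ rowTarget x (edge (Y i) (Y j))
    rowLabels = hit-every-pair-set rowTarget rare

    colLabels : ∃ λ (f : Fin (N * N) → Fin r) → ∀ y (X : Fin (h + h) → Fin N) → Injective _≡_ _≡_ X →
      ∃ λ i → ∃ λ j → ¬ i ≡ j × f (edge (X i) (X j)) ≡ colTarget y (edge (X i) (X j))
    colLabels = hit-every-pair-set colTarget rare

  rowLabel colLabel : Fin (N * N) → Fin r
  rowLabel = proj₁ rowLabels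
  colLabel = proj₁ colLabels

  redIf : {P : Set} → Dec P → Colour
  redIf (yes _) = red
  redIf (no _)  = blue

  redIf-red : {P : Set} (d : Dec P) → redIf d ≡ red → P
  redIf-red (yes p) _ = p

  redIf-yes : {P : Set} (d : Dec P) → P → redIf d ≡ red
  redIf-yes (yes _) _ = refl
  redIf-yes (no ¬p) p = contradiction p ¬p

  rowColour colColour : Fin N → Fin (N * N) → Colour
  rowColour x e = redIf (rowLabel e FinP.≟ rowTarget x e)
  colColour y e = redIf (colLabel e FinP.≟ colTarget y e)

  χ : Colouring N
  χ (x , y) (x′ , y′) with x FinP.≟ x′ | y FinP.≟ y′
  ... | yes _ | _     = rowColour x (edge y y′)
  ... | no _  | yes _ = colColour y (edge x x′)
  ... | no _  | no _  = red

  χ-sym : Symmetric χ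
  χ-sym (x , y) (x′ , y′) with x FinP.≟ x′ | x′ FinP.≟ x | y FinP.≟ y′ | y′ FinP.≟ y
  ... | yes refl | yes _  | _        | _      = cong (rowColour x) (edge-sym y y′)
  ... | yes e    | no ne  | _        | _      = contradiction (sym e) ne
  ... | no ne    | yes e  | _        | _      = contradiction (sym e) ne
  ... | no _     | no _   | yes refl | yes _  = cong (colColour y) (edge-sym x x′)
  ... | no _     | no _   | yes e    | no ne  = contradiction (sym e) ne
  ... | no _     | no _   | no ne    | yes e  = contradiction (sym e) ne
  ... | no _     | no _   | no _     | no _   = refl

  χ-row : ∀ x y y′ → χ (x , y) (x , y′) ≡ rowColour x (edge y y′)
  χ-row x y y′ with x FinP.≟ x
  ... | yes _ = refl
  ... | no ne = contradiction refl ne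

  χ-col : ∀ x x′ y → ¬ x ≡ x′ → χ (x , y) (x′ , y) ≡ colColour y (edge x x′)
  χ-col x x′ y x≢x′ with x FinP.≟ x′ | y FinP.≟ y
  ... | yes e | _     = contradiction e x≢x′
  ... | no _  | yes _ = refl
  ... | no _  | no ne = contradiction refl ne

  spelled-bits : ∀ x x′ y y′ → ¬ y ≡ y′ → spelled x (y , y′) ≡ spelled x′ (y , y′) →
    ∀ i → w y i ≡ w y′ i → bits x i ≡ bits x′ i
  spelled-bits x x′ y y′ y≢y′ = restrict-injective T (w y) (w y′) (bits x) (bits x′) (proj₂ codebook y y′ y≢y′)

  rowTarget-bits : ∀ x x′ y y′ → ¬ y ≡ y′ → rowTarget x (edge y y′) ≡ rowTarget x′ (edge y y′) →
    ∀ i → w y i ≡ w y′ i → bits x i ≡ bits x′ i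
  rowTarget-bits x x′ y y′ y≢y′ eq i same = by-ends (ends-edge y y′)
    where
    spelling : spelled x (ends (edge y y′)) ≡ spelled x′ (ends (edge y y′))
    spelling = cast-injective r≡ eq
    by-ends : ends (edge y y′) ≡ (y , y′) ⊎ ends (edge y y′) ≡ (y′ , y) → bits x i ≡ bits x′ i
    by-ends (inj₁ e) = spelled-bits x x′ y y′ y≢y′ (subst (λ z → spelled x z ≡ spelled x′ z) e spelling) i same
    by-ends (inj₂ e) = spelled-bits x x′ y′ y (y≢y′ ∘ sym) (subst (λ z → spelled x z ≡ spelled x′ z) e spelling) i (sym same)

  symbolOf-agree : ∀ u v y y′ → ¬ u ≡ v → symbolOf y (u , v) ≡ symbolOf y′ (u , v) →
    ∃ λ i → ¬ bits u i ≡ bits v i × w y i ≡ w y′ i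
  symbolOf-agree u v y y′ u≢v eq with differ? u v
  ... | yes (i , ne) = i , ne , eq
  ... | no same      = contradiction (finToFun-injective λ i → decidable-stable (bits u i FinP.≟ bits v i) λ ne → same (i , ne)) u≢v
    where
    finToFun-injective : (∀ i → bits u i ≡ bits v i) → u ≡ v
    finToFun-injective e = trans (sym (FinP.funToFin-finToFin {D} {2} u)) (trans (funToFin-cong e) (FinP.funToFin-finToFin {D} {2} v))

  colTarget-agree : ∀ x x′ y y′ → ¬ x ≡ x′ → colTarget y (edge x x′) ≡ colTarget y′ (edge x x′) →
    ∃ λ i → ¬ bits x i ≡ bits x′ i × w y i ≡ w y′ i
  colTarget-agree x x′ y y′ x≢x′ eq = by-ends (ends-edge x x′)
    where
    by-ends : ends (edge x x′) ≡ (x , x′) ⊎ ends (edge x x′) ≡ (x′ , x) → ∃ λ i → ¬ bits x i ≡ bits x′ i × w y i ≡ w y′ i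
    by-ends (inj₁ e) = symbolOf-agree x x′ y y′ x≢x′ (subst (λ z → symbolOf y z ≡ symbolOf y′ z) e eq)
    by-ends (inj₂ e) = let (i , ne , same) = symbolOf-agree x′ x y y′ (x≢x′ ∘ sym) (subst (λ z → symbolOf y z ≡ symbolOf y′ z) e eq)
                       in i , ne ∘ sym , same

  -- The two column edges share the label of the row pair and so provide a place `i` where the rows
  -- differ and the words of `y` and `y′` agree. The two row edges share the label of the column
  -- pair, which spells the same bit at `i` for both rows.
  no-red-square : ∀ x x′ y y′ → ¬ x ≡ x′ → ¬ y ≡ y′ → χ (x , y) (x , y′) ≡ red → χ (x′ , y) (x′ , y′) ≡ red →
    χ (x , y) (x′ , y) ≡ red → χ (x , y′) (x′ , y′) ≡ red → ⊥
  no-red-square x x′ y y′ x≢x′ y≢y′ row row′ col col′ =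
    let (i , ne , same) = colTarget-agree x x′ y y′ x≢x′ (trans (sym (colEq y col)) (colEq y′ col′))
    in ne (rowTarget-bits x x′ y y′ y≢y′ (trans (sym (rowEq x row)) (rowEq x′ row′)) i same)
    where
    rowEq : ∀ z → χ (z , y) (z , y′) ≡ red → rowLabel (edge y y′) ≡ rowTarget z (edge y y′)
    rowEq z c = redIf-red (rowLabel (edge y y′) FinP.≟ rowTarget z (edge y y′)) (trans (sym (χ-row z y y′)) c)
    colEq : ∀ z → χ (x , z) (x′ , z) ≡ red → colLabel (edge x x′) ≡ colTarget z (edge x x′)
    colEq z c = redIf-red (colLabel (edge x x′) FinP.≟ colTarget z (edge x x′)) (trans (sym (χ-col x x′ z x≢x′)) c)

  no-red-subgrid : ∀ {a b} → 2 ≤ a → 2 ≤ b → ¬ HasRedSubgrid a b χ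
  no-red-subgrid {suc (suc a)} {suc (suc b)} _ _ (X , Y , iX , iY , o , red-edges) = by-orientation o red-edges
    where
    i₀ i₁ : Fin (suc (suc a))
    i₀ = zero
    i₁ = suc zero
    j₀ j₁ : Fin (suc (suc b))
    j₀ = zero
    j₁ = suc zero
    X≢ : ¬ X i₀ ≡ X i₁
    X≢ e with iX e
    ... | ()
    Y≢ : ¬ Y j₀ ≡ Y j₁
    Y≢ e with iY e
    ... | ()
    by-orientation : ∀ o → RedGrid χ X Y o → ⊥
    by-orientation straight g = no-red-square (X i₀) (X i₁) (Y j₀) (Y j₁) X≢ Y≢
      (g i₀ i₀ j₀ j₁ (inj₁ (refl , Y≢))) (g i₁ i₁ j₀ j₁ (inj₁ (refl , Y≢)))
      (g i₀ i₁ j₀ j₀ (inj₂ (X≢ , refl))) (g i₀ i₁ j₁ j₁ (inj₂ (X≢ , refl)))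
    by-orientation swapped g = no-red-square (Y j₀) (Y j₁) (X i₀) (X i₁) Y≢ X≢
      (g i₀ i₁ j₀ j₀ (inj₁ (refl , X≢))) (g i₀ i₁ j₁ j₁ (inj₁ (refl , X≢)))
      (g i₀ i₀ j₀ j₁ (inj₂ (Y≢ , refl))) (g i₁ i₁ j₀ j₁ (inj₂ (Y≢ , refl)))
  no-red-subgrid {zero} ()
  no-red-subgrid {suc zero} (s≤s ())
  no-red-subgrid {suc (suc a)} {zero} _ ()
  no-red-subgrid {suc (suc a)} {suc zero} _ (s≤s ())

  Clique : (Fin (h + h) → Vertex N) → Set
  Clique g = Injective _≡_ _≡_ g × (∀ i j → ¬ i ≡ j → Adj (g i) (g j) × χ (g i) (g j) ≡ blue)

  no-blue-row : (g : Fin (h + h) → Vertex N) → Clique g → (x : Fin N) → ¬ (∀ i → proj₁ (g i) ≡ x)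
  no-blue-row g (inj , edges) x in-row with proj₂ rowLabels x (proj₂ ∘ g)
    (λ {i} {j} e → inj (cong₂ _,_ (trans (in-row i) (sym (in-row j))) e))
  ... | i , j , ne , hit = red≢blue (trans (sym (trans (χ-row x (proj₂ (g i)) (proj₂ (g j)))
          (redIf-yes (rowLabel e FinP.≟ rowTarget x e) hit)))
          (subst₂ (λ z z′ → χ (z , proj₂ (g i)) (z′ , proj₂ (g j)) ≡ blue) (in-row i) (in-row j) (proj₂ (edges i j ne))))
    where
    e = edge (proj₂ (g i)) (proj₂ (g j))
    red≢blue : ¬ red ≡ blue
    red≢blue ()

  no-blue-column : (g : Fin (h + h) → Vertex N) → Clique g → (y : Fin N) → ¬ (∀ i → proj₂ (g i) ≡ y)
  no-blue-column g (inj , edges) y in-col with proj₂ colLabels y (proj₁ ∘ g)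
    (λ {i} {j} e → inj (cong₂ _,_ e (trans (in-col i) (sym (in-col j)))))
  ... | i , j , ne , hit = red≢blue (trans (sym (trans (χ-col (proj₁ (g i)) (proj₁ (g j)) y x≢)
          (redIf-yes (colLabel e FinP.≟ colTarget y e) hit)))
          (subst₂ (λ z z′ → χ (proj₁ (g i) , z) (proj₁ (g j) , z′) ≡ blue) (in-col i) (in-col j) (proj₂ (edges i j ne))))
    where
    e = edge (proj₁ (g i)) (proj₁ (g j))
    x≢ : ¬ proj₁ (g i) ≡ proj₁ (g j)
    x≢ eq = ne (inj (cong₂ _,_ eq (trans (in-col i) (sym (in-col j)))))
    red≢blue : ¬ red ≡ blue
    red≢blue ()

  no-clique : (g : Fin (h + h) → Vertex N) → ¬ Clique g
  no-clique g clique with clique-in-line g (λ i j ne → proj₁ (proj₂ clique i j ne)) (≤-trans 1≤h (m≤m+n h h))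
  ... | inj₁ (x , in-row) = no-blue-row g clique x in-row
  ... | inj₂ (y , in-col) = no-blue-column g clique y in-col

  no-blue-clique : ¬ HasBlueClique n χ
  no-blue-clique (g , inj , edges) = no-clique (λ i → g (inject≤ i n-large))
    ((λ e → FinP.inject≤-injective n-large n-large _ _ (inj e)) ,
     λ i j ne → edges _ _ (λ e → ne (FinP.inject≤-injective n-large n-large _ _ e)))

  not-arrows : ∀ {a b} → 2 ≤ a → 2 ≤ b → ¬ Arrows a b n N
  not-arrows 2≤a 2≤b arr with arr χ χ-sym
  ... | inj₁ g = no-red-subgrid 2≤a 2≤b g
  ... | inj₂ c = no-blue-clique c

-- Size of the lower bound

3t²+1≤4^t : ∀ t → suc (3 * (t * t)) ≤ 2 ^ (2 * t)
3t²+1≤4^t zero          = ≤-refl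
3t²+1≤4^t (suc zero)    = ≤-refl
3t²+1≤4^t (suc (suc t)) = begin
  1 + 3 * ((2 + t) * (2 + t))                        ≤⟨ m≤m+n _ (9 * (t * t) + 12 * t + 3) ⟩
  1 + 3 * ((2 + t) * (2 + t)) + (9 * (t * t) + 12 * t + 3) ≡⟨ lem t ⟩
  4 * (1 + 3 * ((1 + t) * (1 + t)))                  ≤⟨ *-monoʳ-≤ 4 (3t²+1≤4^t (suc t)) ⟩
  2 ^ 2 * 2 ^ (2 * suc t)                            ≡⟨ sym (^-distribˡ-+-* 2 2 (2 * suc t)) ⟩
  2 ^ (2 + 2 * suc t)                                ≡⟨ cong (2 ^_) (lem′ t) ⟩
  2 ^ (2 * suc (suc t))                              ∎
  where
  open ≤-Reasoning
  lem : ∀ t → 1 + 3 * ((2 + t) * (2 + t)) + (9 * (t * t) + 12 * t + 3) ≡ 4 * (1 + 3 * ((1 + t) * (1 + t)))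
  lem = solve-∀
  lem′ : ∀ t → 2 + 2 * (1 + t) ≡ 2 * (2 + t)
  lem′ = solve-∀

-- The parameters are D = t², T = 2t and r = 4^t = 2^T. `h` is r (3D + 1), as `rare-events` demands;
-- `3t²+1≤4^t` gives h ≤ 16^t, and the excluded cliques have 2h ≤ 2^(4t + 1) vertices.
not-arrows-power : ∀ t n {a b} → 2 ^ suc (4 * t) ≤ n → 2 ≤ a → 2 ≤ b → ¬ Arrows a b n (2 ^ (t * t))
not-arrows-power t n n-large 2≤a 2≤b =
  Avoiding.not-arrows r′ (t * t) (2 * t) h n eq fit (rare-events r′ (t * t)) (s≤s z≤n) large 2≤a 2≤b
  where
  r′ h : ℕ
  r′ = pred (2 ^ (2 * t))
  h = suc r′ * suc (3 * (t * t))
  eq : 2 ^ (2 * t) ≡ suc r′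
  eq = sym (suc-pred (2 ^ (2 * t)) {{m^n≢0 2 (2 * t)}})
  open ≤-Reasoning
  fit : 2 ^ (t * t) * 2 ^ (t * t) ≤ suc r′ ^ suc (2 * t)
  fit = begin
    2 ^ (t * t) * 2 ^ (t * t)       ≡⟨ sym (^-distribˡ-+-* 2 (t * t) (t * t)) ⟩
    2 ^ (t * t + t * t)             ≤⟨ ^-monoʳ-≤ 2 (≤-trans (m≤m+n (t * t + t * t) (2 * (t * t) + 2 * t)) (≤-reflexive (lem t))) ⟩
    2 ^ (2 * t * suc (2 * t))       ≡⟨ sym (^-*-assoc 2 (2 * t) (suc (2 * t))) ⟩
    (2 ^ (2 * t)) ^ suc (2 * t)     ≡⟨ cong (_^ suc (2 * t)) eq ⟩
    suc r′ ^ suc (2 * t)            ∎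
    where
    lem : ∀ t → t * t + t * t + (2 * (t * t) + 2 * t) ≡ 2 * t * (1 + 2 * t)
    lem = solve-∀
  large : h + h ≤ n
  large = begin
    h + h                                                   ≤⟨ +-mono-≤ half half ⟩
    2 ^ (4 * t) + 2 ^ (4 * t)                               ≡⟨ cong (2 ^ (4 * t) +_) (sym (+-identityʳ _)) ⟩
    2 ^ suc (4 * t)                                         ≤⟨ n-large ⟩
    n                                                       ∎
    where
    lem : ∀ t → 2 * t + 2 * t ≡ 4 * t
    lem = solve-∀
    half : h ≤ 2 ^ (4 * t)
    half = begin
      suc r′ * suc (3 * (t * t))     ≤⟨ *-monoʳ-≤ (suc r′) (3t²+1≤4^t t) ⟩
      suc r′ * 2 ^ (2 * t)           ≡⟨ cong (_* 2 ^ (2 * t)) (sym eq) ⟩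
      2 ^ (2 * t) * 2 ^ (2 * t)      ≡⟨ trans (sym (^-distribˡ-+-* 2 (2 * t) (2 * t))) (cong (2 ^_) (lem t)) ⟩
      2 ^ (4 * t)                    ∎

-- For the largest t with 2^(4t + 1) ≤ n one has log n < 4t + 5, and (4t + 5)² ≤ 81 max(1, t²), with
-- equality at t = 1. This is the origin of 81.
lower-estimate : ∀ a b n → 2 ≤ b → b ≤ a → 2 ≤ n → ∀ N → Arrows a b n N → LowerBound 1 81 n N
lower-estimate a b n 2≤b b≤a 2≤n N arr p q 1≤q atLeast = begin
  2 ^ (1 * (p * p))                 ≡⟨ cong (2 ^_) (*-identityˡ (p * p)) ⟩
  2 ^ (p * p)                       ≤⟨ ^-monoʳ-≤ 2 (*-mono-≤ p≤ p≤) ⟩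
  2 ^ ((5 + 4 * t) * q * ((5 + 4 * t) * q)) ≤⟨ ^-monoʳ-≤ 2 square≤ ⟩
  2 ^ ((1 ⊔ t * t) * (81 * (q * q))) ≡⟨ sym (^-*-assoc 2 (1 ⊔ t * t) (81 * (q * q))) ⟩
  (2 ^ (1 ⊔ t * t)) ^ (81 * (q * q)) ≤⟨ ^-monoˡ-≤ (81 * (q * q)) N≥ ⟩
  N ^ (81 * (q * q))                ∎
  where
  open ≤-Reasoning
  scaleOf : ∃ λ t → 2 ^ suc (4 * t) ≤ n × ¬ 2 ^ suc (4 * suc t) ≤ n
  scaleOf = largest (λ t → 2 ^ suc (4 * t) ≤? n) 2≤n n (<⇒≱ (begin-strict
    n                    <⟨ suc≤2^ n ⟩
    2 ^ n                ≤⟨ ^-monoʳ-≤ 2 (≤-trans (m≤n*m n 4) (n≤1+n (4 * n))) ⟩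
    2 ^ suc (4 * n)      ∎))
  t = proj₁ scaleOf
  N> : 2 ^ (t * t) < N
  N> = ≰⇒> λ le → not-arrows-power t n (proj₁ (proj₂ scaleOf)) (≤-trans 2≤b b≤a) 2≤b (arrows-mono le arr)
  -- At t = 0 the exponent t² is useless; the bound N ≥ 2 needed there comes from the strict
  -- inequality `N>`.
  N≥ : 2 ^ (1 ⊔ t * t) ≤ N
  N≥ with ⊔-sel 1 (t * t)
  ... | inj₁ e = subst (λ z → 2 ^ z ≤ N) (sym e) (≤-trans (s≤s (m^n>0 2 (t * t))) N>)
  ... | inj₂ e = subst (λ z → 2 ^ z ≤ N) (sym e) (<⇒≤ N>)
  p≤ : p ≤ (5 + 4 * t) * q
  p≤ = ≮⇒≥ λ lt → <⇒≱ (^-monoʳ-< 2 (s≤s (s≤s z≤n)) lt) (begin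
    2 ^ p                           ≤⟨ atLeast ⟩
    n ^ q                           ≤⟨ ^-monoˡ-≤ q (<⇒≤ (≰⇒> (proj₂ (proj₂ scaleOf)))) ⟩
    (2 ^ suc (4 * suc t)) ^ q       ≡⟨ cong (λ z → (2 ^ z) ^ q) (lem t) ⟩
    (2 ^ (5 + 4 * t)) ^ q           ≡⟨ ^-*-assoc 2 (5 + 4 * t) q ⟩
    2 ^ ((5 + 4 * t) * q)           ∎)
    where
    lem : ∀ t → 1 + 4 * (1 + t) ≡ 5 + 4 * t
    lem = solve-∀
  linear≤ : ∀ t → (5 + 4 * t) * (5 + 4 * t) ≤ (1 ⊔ t * t) * 81
  linear≤ zero    = m≤n+m 25 56
  linear≤ (suc t) = ≤-trans (begin
    (5 + 4 * suc t) * (5 + 4 * suc t)                  ≤⟨ m≤m+n _ (65 * (t * t) + 90 * t) ⟩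
    (5 + 4 * suc t) * (5 + 4 * suc t) + (65 * (t * t) + 90 * t) ≡⟨ lem t ⟩
    suc t * suc t * 81                                 ∎) (*-monoˡ-≤ 81 (m≤n⊔m 1 (suc t * suc t)))
    where
    lem : ∀ t → (5 + 4 * (1 + t)) * (5 + 4 * (1 + t)) + (65 * (t * t) + 90 * t) ≡ (1 + t) * (1 + t) * 81
    lem = solve-∀
  square≤ : (5 + 4 * t) * q * ((5 + 4 * t) * q) ≤ (1 ⊔ t * t) * (81 * (q * q))
  square≤ = begin
    (5 + 4 * t) * q * ((5 + 4 * t) * q)      ≡⟨ lem (5 + 4 * t) q ⟩
    (5 + 4 * t) * (5 + 4 * t) * (q * q)      ≤⟨ *-monoˡ-≤ (q * q) (linear≤ t) ⟩
    (1 ⊔ t * t) * 81 * (q * q)               ≡⟨ *-assoc (1 ⊔ t * t) 81 (q * q) ⟩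
    (1 ⊔ t * t) * (81 * (q * q))             ∎
    where
    lem : ∀ x q → x * q * (x * q) ≡ x * x * (q * q)
    lem = solve-∀

theorem1p4 : Σ ℕ λ u → Σ ℕ λ v → 1 ≤ u × 1 ≤ v ×
    ((a : ℕ) → Σ ℕ λ u' → Σ ℕ λ v' → 1 ≤ u' × 1 ≤ v' ×
    ((b : ℕ) → 2 ≤ b → b ≤ a → (n : ℕ) → 2 ≤ n →
    Σ ℕ λ N → IsGr a b n N × LowerBound u v n N × UpperBound u' v' b n N))
theorem1p4 = 1 , 81 , s≤s z≤n , s≤s z≤n , λ a →
  4 * suc (upper-exponent a) , 1 , s≤s z≤n , s≤s z≤n , λ b 2≤b b≤a n 2≤n →
  let (N₀ , arr , upper)       = upper-estimate a b n 2≤b b≤a 2≤n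
      (N , N≤N₀ , arrN , minN) = least (arrows? a b n) N₀ arr
  in N , (arrN , minN) , lower-estimate a b n 2≤b b≤a 2≤n N arrN , upper N N≤N₀
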